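{- Let $\mathcal{P}$ be the set of integer partitions that satisfy Condition($1$) and in which the part $1$ appears at most once. Then, as formal power series in $x,q$, writing $N=i+2j+3k$, $$\sum_{\pi\in\mathcal{P}}x^{\ell(\pi)}q^{|\pi|}=\sum_{i,j,k\ge 0}\frac{x^{N}q^{\frac{N(N-1)}{2}+i+j^2+2j+4k}}{(q;q)_i\,(q^2;q^2)_j\,(q^3;q^3)_k}.$$
   Context: Partitions are finite weakly increasing sequences of positive integers (the empty partition is included); $\ell(\pi)$ is the number of parts and $|\pi|$ the sum of the parts of $\pi$. For a fixed integer $c$, a partition $\pi=\lambda_1+\lambda_2+\cdots+\lambda_m$ with $\lambda_1\le\lambda_2\le\cdots\le\lambda_m$ satisfies Condition($c$) if $\lambda_{s+3}-\lambda_s\ge 3$ for all $1\le s\le m-3$, and, for all $1\le s\le m-2$, if $\lambda_{s+2}-\lambda_s\le 1$ then $\lambda_s+\lambda_{s+1}+\lambda_{s+2}\equiv c\pmod 3$. For $n\ge 0$, $(a;q)_n=\prod_{0\le t<n}(1-aq^t)$. All identities are identities of formal power series. -}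

module Defs where

open import Data.Nat.Base as ℕ using (ℕ; zero; suc; _∸_)
import Data.Nat.Properties as ℕ
open import Data.Nat.DivMod using () renaming (_/_ to _div_)
open import Data.Nat.ListAction using (sum)
open import Data.Integer.Base as ℤ using (ℤ; +_; 0ℤ; 1ℤ)
import Data.Integer.Properties as ℤ
open import Data.Integer.Divisibility using (_∣_)
open import Data.Fin.Base using (Fin; zero; suc; toℕ)
open import Data.Vec.Base as Vec using (Vec; []; _∷_)
open import Data.List.Base as List using (List; length; lookup; filter; map; foldr)
open import Data.List.Membership.Propositional using (_∉_)
open import Data.List.Relation.Unary.All using (All)
open import Data.List.Relation.Unary.Sorted.TotalOrder ℕ.≤-totalOrder using (Sorted)
open import Data.List.Relation.Unary.Unique.Propositional using (Unique)
open import Data.Product.Base using (_×_; _,_; ∃)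
open import Function.Base using (_∘_)
open import Relation.Nullary.Decidable using (yes; no)
open import Relation.Binary.PropositionalEquality
open import Algebra.Properties.CommutativeMonoid.Sum ℤ.+-0-commutativeMonoid
  using (sum-syntax; sum⁺-syntax; sum-cong-≗)

-- The n-th value is the coefficient of q^n.
Series : Set
Series = ℕ → ℤ

infixl 7 _*_
infixl 6 _-_
infixr 8 _^_

q^_ : ℕ → Series
(q^ e) n with n ℕ.≟ e
... | yes _ = 1ℤ
... | no  _ = 0ℤ

one : Series
one = q^ 0

_-_ : Series → Series → Series
(f - g) n = f n ℤ.- g n

_*_ : Series → Series → Series
(f * g) n = ∑[ k ≤ n ] (f (toℕ k) ℤ.* g (n ∸ toℕ k))

_^_ : Series → ℕ → Series
f ^ zero  = one
f ^ suc n = f ^ n * f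

-- ⟨ a ⨾ r ⟩ n is the q-shifted factorial (a;r)_n with base r.
⟨_⨾_⟩ : Series → Series → ℕ → Series
⟨ a ⨾ r ⟩ zero    = one
⟨ a ⨾ r ⟩ (suc n) = ⟨ a ⨾ r ⟩ n * (one - a * r ^ n)

-- The reciprocal g of f, for f with constant coefficient 1: solving
-- f * g = one degree by degree gives g₀ = 1 and
-- gₙ₊₁ = - ∑_{k ≤ n} fₖ₊₁ gₙ₋ₖ.  The vector lists gₙ, …, g₀ in this order.
recipCoeffs : Series → (n : ℕ) → Vec ℤ (suc n)
recipCoeffs f zero    = 1ℤ ∷ []
recipCoeffs f (suc n) =
  ℤ.- (∑[ k ≤ n ] (f (suc (toℕ k)) ℤ.* Vec.lookup (recipCoeffs f n) k))
    ∷ recipCoeffs f n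

recip : (f : Series) → f 0 ≡ 1ℤ → Series
recip f _ n = Vec.head (recipCoeffs f n)

lookup-recipCoeffs : ∀ f f₀ n (k : Fin (suc n)) →
  Vec.lookup (recipCoeffs f n) k ≡ recip f f₀ (n ∸ toℕ k)
lookup-recipCoeffs f f₀ zero    zero    = refl
lookup-recipCoeffs f f₀ (suc n) zero    = refl
lookup-recipCoeffs f f₀ (suc n) (suc k) = lookup-recipCoeffs f f₀ n k

*-recip : ∀ f (f₀ : f 0 ≡ 1ℤ) → f * recip f f₀ ≗ one
*-recip f f₀ zero    rewrite f₀ = refl
*-recip f f₀ (suc n) = begin
  f 0 ℤ.* (ℤ.- s) ℤ.+ t  ≡⟨ cong (λ c → c ℤ.* (ℤ.- s) ℤ.+ t) f₀ ⟩
  1ℤ ℤ.* (ℤ.- s) ℤ.+ t   ≡⟨ cong (ℤ._+ t) (ℤ.*-identityˡ (ℤ.- s)) ⟩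
  (ℤ.- s) ℤ.+ t          ≡⟨ cong (λ u → (ℤ.- s) ℤ.+ u) (sym s≡t) ⟩
  (ℤ.- s) ℤ.+ s          ≡⟨ ℤ.+-inverseˡ s ⟩
  0ℤ                     ∎
  where
  open ≡-Reasoning
  s t : ℤ
  s = ∑[ k ≤ n ] (f (suc (toℕ k)) ℤ.* Vec.lookup (recipCoeffs f n) k)
  t = ∑[ k ≤ n ] (f (suc (toℕ k)) ℤ.* recip f f₀ (n ∸ toℕ k))
  s≡t : s ≡ t
  s≡t = sum-cong-≗ {suc n}
    (λ k → cong (f (suc (toℕ k)) ℤ.*_) (lookup-recipCoeffs f f₀ n k))

*-constant : ∀ f g → (f * g) 0 ≡ f 0 ℤ.* g 0
*-constant f g = ℤ.+-identityʳ (f 0 ℤ.* g 0)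

*-constant-1 : ∀ f g → f 0 ≡ 1ℤ → g 0 ≡ 1ℤ → (f * g) 0 ≡ 1ℤ
*-constant-1 f g f₀ g₀ = trans (*-constant f g) (cong₂ ℤ._*_ f₀ g₀)

⟨⨾⟩-constant : ∀ a r n → a 0 ≡ 0ℤ → ⟨ a ⨾ r ⟩ n 0 ≡ 1ℤ
⟨⨾⟩-constant a r zero    a₀ = refl
⟨⨾⟩-constant a r (suc n) a₀ =
  *-constant-1 (⟨ a ⨾ r ⟩ n) (one - a * r ^ n) (⟨⨾⟩-constant a r n a₀)
    (cong (λ u → 1ℤ ℤ.- u)
      (trans (*-constant a (r ^ n)) (cong (ℤ._* (r ^ n) 0) a₀)))

-- The value at m and n is the coefficient of x^m q^n.
Series₂ : Set
Series₂ = ℕ → ℕ → ℤ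

infix 5 x^_∙_

x^_∙_ : ℕ → Series → Series₂
(x^ N ∙ f) m n with m ℕ.≟ N
... | yes _ = f n
... | no  _ = 0ℤ

-- HasSum P f S: the sum of f i over all i satisfying P is a well-defined
-- formal power series, and it equals S.  That is, for each monomial
-- x^m q^n only finitely many of the f i (those listed in the support, each
-- once) may contribute, and their contributions add up to S m n.
HasSum : {I : Set} → (I → Set) → (I → Series₂) → Series₂ → Set
HasSum {I} P f S = ∀ m n → ∃ λ (support : List I) →
  Unique support ×
  All P support ×
  (∀ i → P i → i ∉ support → f i m n ≡ 0ℤ) ×
  foldr ℤ._+_ 0ℤ (map (λ i → f i m n) support) ≡ S m n

record IsPartition (π : List ℕ) : Set where
  field
    increasing : Sorted π
    positive   : All (1 ℕ.≤_) π

-- The inequalities between differences of parts are written additively to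
-- avoid truncated subtraction.
record Condition (c : ℤ) (π : List ℕ) : Set where
  field
    gap : ∀ (s t : Fin (length π)) → toℕ t ≡ 3 ℕ.+ toℕ s →
      3 ℕ.+ lookup π s ℕ.≤ lookup π t
    congruence : ∀ (s t u : Fin (length π)) →
      toℕ t ≡ 1 ℕ.+ toℕ s → toℕ u ≡ 2 ℕ.+ toℕ s →
      lookup π u ℕ.≤ 1 ℕ.+ lookup π s →
      + 3 ∣ (+ (lookup π s ℕ.+ lookup π t ℕ.+ lookup π u) ℤ.- c)

multiplicity : ℕ → List ℕ → ℕ
multiplicity a π = length (filter (ℕ._≟ a) π)

record 𝒫 (π : List ℕ) : Set where
  field
    isPartition   : IsPartition π
    condition     : Condition (+ 1) π
    atMostOneOne  : multiplicity 1 π ℕ.≤ 1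

partitionTerm : List ℕ → Series₂
partitionTerm π = x^ length π ∙ q^ (sum π)

denominator : ℕ → ℕ → ℕ → Series
denominator i j k =
  ⟨ q^ 1 ⨾ q^ 1 ⟩ i * ⟨ q^ 2 ⨾ q^ 2 ⟩ j * ⟨ q^ 3 ⨾ q^ 3 ⟩ k

denominator-constant : ∀ i j k → denominator i j k 0 ≡ 1ℤ
denominator-constant i j k =
  *-constant-1 (⟨ q^ 1 ⨾ q^ 1 ⟩ i * ⟨ q^ 2 ⨾ q^ 2 ⟩ j) (⟨ q^ 3 ⨾ q^ 3 ⟩ k)
    (*-constant-1 (⟨ q^ 1 ⨾ q^ 1 ⟩ i) (⟨ q^ 2 ⨾ q^ 2 ⟩ j)
      (⟨⨾⟩-constant (q^ 1) (q^ 1) i refl)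
      (⟨⨾⟩-constant (q^ 2) (q^ 2) j refl))
    (⟨⨾⟩-constant (q^ 3) (q^ 3) k refl)

multisumTerm : ℕ × ℕ × ℕ → Series₂
multisumTerm (i , j , k) =
  x^ N ∙ q^ exponent * recip (denominator i j k) (denominator-constant i j k)
  where
  N exponent : ℕ
  N        = i ℕ.+ 2 ℕ.* j ℕ.+ 3 ℕ.* k
  exponent = (N ℕ.* (N ∸ 1)) div 2 ℕ.+ i ℕ.+ j ℕ.^ 2 ℕ.+ 2 ℕ.* j ℕ.+ 4 ℕ.* k

{-# OPTIONS --safe #-}

-- Write S(a,b,c) = ∑ x^N q^{N(N-1)/2 + a i + j² + b j + c k} / ((q;q)_i (q²;q²)_j (q³;q³)_k),
-- so that S(a+t,b+2t,c+3t) arises from S(a,b,c) by x ↦ x q^t.  Clearing the last factor of one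
-- of the three denominators gives
--   S(a,b,c) = S(a+1,b,c) + x q^a S(a+1,b+2,c+3)
--            = S(a,b+2,c) + x² q^{b+2} S(a+2,b+6,c+6)
--            = S(a,b,c+3) + x³ q^{c+3} S(a+3,b+6,c+9),
-- whence C = S(1,2,4) and A = S(1,0,1) satisfy
--   C(x) = A(xq) + x q C(xq),   A(x) = C(x) + x² q² C(xq²) + x³ q⁴ A(xq³).
-- Here A corresponds to dropping the bound on the number of 1s: a partition counted by C has no
-- or one part 1, and one counted by A but not by C begins with 1+1 or 1+1+2, after which all
-- parts are at least 3 respectively 4.  Removing these initial parts and lowering the others
-- shows that the two partition generating functions satisfy the same system, which determines
-- all coefficients.

module Submission where

open import Defs
open import Data.Nat.Base as ℕ using (ℕ; zero; suc; z≤n; s≤s)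
import Data.Nat.Properties as ℕ
import Data.Nat.DivMod as ℕ
import Data.Nat.Divisibility as ℕ
import Data.Nat.Tactic.RingSolver as ℕ-Solver
open import Data.Nat.ListAction using (sum)
open import Data.Nat.ListAction.Properties using (sum-++)
open import Data.Integer.Base as ℤ using (ℤ; +_; 0ℤ; 1ℤ)
import Data.Integer.Properties as ℤ
open import Data.Integer.Divisibility using (_∣_)
import Data.Integer.Tactic.RingSolver as ℤ-Solver
open import Data.Fin.Base using (Fin; zero; suc; toℕ)
open import Data.List.Base
  using (List; []; _∷_; _++_; map; foldr; length; lookup; applyUpTo; upTo; cartesianProduct)
import Data.List.Properties as List
open import Data.List.Membership.Propositional using (_∈_; _∉_)
open import Data.List.Membership.Propositional.Properties
  using (∈-map⁺; ∈-++⁺ˡ; ∈-++⁺ʳ; ∈-cartesianProduct⁺; ∈-upTo⁺)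
open import Data.List.Relation.Unary.All as All using (All; []; _∷_)
import Data.List.Relation.Unary.All.Properties as All
open import Data.List.Relation.Unary.Any using (here)
open import Data.List.Relation.Unary.Linked as Linked using ([]; [-]; _∷_)
open import Data.List.Relation.Unary.Sorted.TotalOrder ℕ.≤-totalOrder using (Sorted)
open import Data.List.Relation.Unary.Unique.Propositional using (Unique; []; _∷_)
import Data.List.Relation.Unary.Unique.Propositional.Properties as Unique
open import Data.Product.Base using (_×_; _,_; ∃; proj₁; proj₂)
open import Data.Sum.Base using (_⊎_; inj₁; inj₂)
open import Data.Unit.Base using (⊤; tt)
open import Function.Base using (_∘_; id)
open import Relation.Nullary.Decidable using (yes; no)
open import Relation.Nullary.Negation using (¬_; contradiction)
open import Relation.Unary using (U)
open import Relation.Binary.PropositionalEquality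
open import Algebra.Bundles using (CommutativeSemigroup)
open import Algebra.Properties.CommutativeMonoid.Sum ℤ.+-0-commutativeMonoid
  using (sum-cong-≗)

-- Series form a commutative monoid

*-cong : ∀ {f f′ g g′} → f ≗ f′ → g ≗ g′ → f * g ≗ f′ * g′
*-cong f≗f′ g≗g′ n =
  sum-cong-≗ {suc n} (λ k → cong₂ ℤ._*_ (f≗f′ (toℕ k)) (g≗g′ (n ℕ.∸ toℕ k)))

*-congʳ : ∀ {f f′} g → f ≗ f′ → f * g ≗ f′ * g
*-congʳ g f≗f′ = *-cong {g = g} f≗f′ (λ _ → refl)

*-distribʳ : ∀ f g h → (λ n → f n ℤ.+ g n) * h ≗ λ n → (f * h) n ℤ.+ (g * h) n
*-distribʳ f g h zero = distrib (f 0) (g 0) (h 0)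
  where
  distrib : ∀ a b c → (a ℤ.+ b) ℤ.* c ℤ.+ 0ℤ ≡ (a ℤ.* c ℤ.+ 0ℤ) ℤ.+ (b ℤ.* c ℤ.+ 0ℤ)
  distrib = ℤ-Solver.solve-∀
*-distribʳ f g h (suc n) = trans
  (cong (λ u → (f 0 ℤ.+ g 0) ℤ.* h (suc n) ℤ.+ u) (*-distribʳ (f ∘ suc) (g ∘ suc) h n))
  (distrib (f 0) (g 0) (h (suc n)) _ _)
  where
  distrib : ∀ a b c u v →
    (a ℤ.+ b) ℤ.* c ℤ.+ (u ℤ.+ v) ≡ (a ℤ.* c ℤ.+ u) ℤ.+ (b ℤ.* c ℤ.+ v)
  distrib = ℤ-Solver.solve-∀

*-scaleˡ : ∀ c f g → (λ n → c ℤ.* f n) * g ≗ λ n → c ℤ.* (f * g) n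
*-scaleˡ c f g zero = scale c (f 0) (g 0)
  where
  scale : ∀ a b d → (a ℤ.* b) ℤ.* d ℤ.+ 0ℤ ≡ a ℤ.* (b ℤ.* d ℤ.+ 0ℤ)
  scale = ℤ-Solver.solve-∀
*-scaleˡ c f g (suc n) = trans
  (cong (λ u → c ℤ.* f 0 ℤ.* g (suc n) ℤ.+ u) (*-scaleˡ c (f ∘ suc) g n))
  (scale c (f 0) (g (suc n)) _)
  where
  scale : ∀ a b d u → (a ℤ.* b) ℤ.* d ℤ.+ a ℤ.* u ≡ a ℤ.* (b ℤ.* d ℤ.+ u)
  scale = ℤ-Solver.solve-∀

-- Induction on the degree for all `f` at once: dropping the constant term of `f * g` leaves `f 0`
-- times the shifted `g` plus the shifted `f` times `g`, and the product with `h` distributes over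
-- these.
*-assoc : ∀ f g h → (f * g) * h ≗ f * (g * h)
*-assoc f g h zero = assoc (f 0) (g 0) (h 0)
  where
  assoc : ∀ a b c → (a ℤ.* b ℤ.+ 0ℤ) ℤ.* c ℤ.+ 0ℤ ≡ a ℤ.* (b ℤ.* c ℤ.+ 0ℤ) ℤ.+ 0ℤ
  assoc = ℤ-Solver.solve-∀
*-assoc f g h (suc n) = begin
  (f 0 ℤ.* g 0 ℤ.+ 0ℤ) ℤ.* h (suc n) ℤ.+
    ((λ m → f 0 ℤ.* g (suc m) ℤ.+ ((f ∘ suc) * g) m) * h) n
    ≡⟨ cong (λ u → (f 0 ℤ.* g 0 ℤ.+ 0ℤ) ℤ.* h (suc n) ℤ.+ u)
         (trans (*-distribʳ (λ m → f 0 ℤ.* g (suc m)) ((f ∘ suc) * g) h n)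
           (cong₂ ℤ._+_ (*-scaleˡ (f 0) (g ∘ suc) h n) (*-assoc (f ∘ suc) g h n))) ⟩
  (f 0 ℤ.* g 0 ℤ.+ 0ℤ) ℤ.* h (suc n) ℤ.+
    (f 0 ℤ.* ((g ∘ suc) * h) n ℤ.+ ((f ∘ suc) * (g * h)) n)
    ≡⟨ assoc (f 0) (g 0) (h (suc n)) _ _ ⟩
  f 0 ℤ.* (g 0 ℤ.* h (suc n) ℤ.+ ((g ∘ suc) * h) n) ℤ.+ ((f ∘ suc) * (g * h)) n ∎
  where
  open ≡-Reasoning
  assoc : ∀ a b c u v →
    (a ℤ.* b ℤ.+ 0ℤ) ℤ.* c ℤ.+ (a ℤ.* u ℤ.+ v) ≡ a ℤ.* (b ℤ.* c ℤ.+ u) ℤ.+ v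
  assoc = ℤ-Solver.solve-∀

-- Convolution unfolds by definition at its first summand; splitting off the last one instead makes
-- commutativity an induction on the degree.
*-suc : ∀ f g n → (f * g) (suc n) ≡ (f * (g ∘ suc)) n ℤ.+ f (suc n) ℤ.* g 0
*-suc f g zero    = swap (f 0 ℤ.* g 1) (f 1 ℤ.* g 0)
  where
  swap : ∀ a b → a ℤ.+ (b ℤ.+ 0ℤ) ≡ (a ℤ.+ 0ℤ) ℤ.+ b
  swap = ℤ-Solver.solve-∀
*-suc f g (suc n) = trans
  (cong (λ u → f 0 ℤ.* g (suc (suc n)) ℤ.+ u) (*-suc (f ∘ suc) g n))
  (sym (ℤ.+-assoc (f 0 ℤ.* g (suc (suc n))) _ _))

*-comm : ∀ f g → f * g ≗ g * f
*-comm f g zero    = cong (ℤ._+ 0ℤ) (ℤ.*-comm (f 0) (g 0))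
*-comm f g (suc n) = begin
  f 0 ℤ.* g (suc n) ℤ.+ ((f ∘ suc) * g) n
    ≡⟨ ℤ.+-comm (f 0 ℤ.* g (suc n)) _ ⟩
  ((f ∘ suc) * g) n ℤ.+ f 0 ℤ.* g (suc n)
    ≡⟨ cong₂ ℤ._+_ (*-comm (f ∘ suc) g n) (ℤ.*-comm (f 0) (g (suc n))) ⟩
  (g * (f ∘ suc)) n ℤ.+ g (suc n) ℤ.* f 0
    ≡⟨ *-suc g f n ⟨
  (g * f) (suc n) ∎
  where open ≡-Reasoning

*-zeroˡ : ∀ g → (λ _ → 0ℤ) * g ≗ λ _ → 0ℤ
*-zeroˡ g zero    = refl
*-zeroˡ g (suc n) = trans (ℤ.+-identityˡ _) (*-zeroˡ g n)

*-identityˡ : ∀ g → one * g ≗ g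
*-identityˡ g zero    = trans (ℤ.+-identityʳ _) (ℤ.*-identityˡ (g 0))
*-identityˡ g (suc n) = begin
  1ℤ ℤ.* g (suc n) ℤ.+ ((one ∘ suc) * g) n
    ≡⟨ cong₂ ℤ._+_ (ℤ.*-identityˡ (g (suc n))) (*-zeroˡ g n) ⟩
  g (suc n) ℤ.+ 0ℤ
    ≡⟨ ℤ.+-identityʳ _ ⟩
  g (suc n) ∎
  where open ≡-Reasoning

*-commutativeSemigroup : CommutativeSemigroup _ _
*-commutativeSemigroup = record
  { Carrier = Series
  ; _≈_ = _≗_
  ; _∙_ = _*_
  ; isCommutativeSemigroup = record
    { isSemigroup = record
      { isMagma = record
        { isEquivalence = record
          { refl = λ _ → refl
          ; sym = λ p n → sym (p n)
          ; trans = λ p r n → trans (p n) (r n)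
          }
        ; ∙-cong = *-cong
        }
      ; assoc = *-assoc
      }
    ; comm = *-comm
    }
  }
open import Algebra.Properties.CommutativeSemigroup *-commutativeSemigroup
  using (xy∙z≈xz∙y)

-- Uniqueness of reciprocals

recip-unique : ∀ f (f₀ : f 0 ≡ 1ℤ) g → f * g ≗ one → g ≗ recip f f₀
recip-unique f f₀ g fg≗one n = begin
  g n                      ≡⟨ *-identityˡ g n ⟨
  (one * g) n              ≡⟨ *-congʳ g (*-recip f f₀) n ⟨
  (f * r * g) n            ≡⟨ xy∙z≈xz∙y f r g n ⟩
  (f * g * r) n            ≡⟨ *-congʳ r fg≗one n ⟩
  (one * r) n              ≡⟨ *-identityˡ r n ⟩
  r n                      ∎
  where
  open ≡-Reasoning
  r : Series
  r = recip f f₀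

-- Multiplying 1/(f r) by `r` clears the factor `r`. Below, `r` is the last factor of one of the
-- three q-factorials.
recip-factor : ∀ f g (f₀ : f 0 ≡ 1ℤ) (g₀ : g 0 ≡ 1ℤ) r → g ≗ f * r →
  r * recip g g₀ ≗ recip f f₀
recip-factor f g f₀ g₀ r g≗fr = recip-unique f f₀ (r * recip g g₀) λ n → begin
  (f * (r * recip g g₀)) n   ≡⟨ *-assoc f r (recip g g₀) n ⟨
  (f * r * recip g g₀) n     ≡⟨ *-congʳ (recip g g₀) g≗fr n ⟨
  (g * recip g g₀) n         ≡⟨ *-recip g g₀ n ⟩
  one n                      ∎
  where open ≡-Reasoning

-- Multiplication by monomials

-- Multiplication by q^e, by recursion on `e` so that coefficients compute. The same operation
-- serves for powers of x in `shift₂`.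
shift : ℕ → Series → Series
shift zero    f n       = f n
shift (suc e) f zero    = 0ℤ
shift (suc e) f (suc n) = shift e f n

shift-cong : ∀ e {f g} → f ≗ g → shift e f ≗ shift e g
shift-cong zero    f≗g n       = f≗g n
shift-cong (suc e) f≗g zero    = refl
shift-cong (suc e) f≗g (suc n) = shift-cong e f≗g n

shift-+ : ∀ e f g → shift e (λ n → f n ℤ.+ g n) ≗ λ n → shift e f n ℤ.+ shift e g n
shift-+ zero    f g n       = refl
shift-+ (suc e) f g zero    = refl
shift-+ (suc e) f g (suc n) = shift-+ e f g n

shift-0 : ∀ e → shift e (λ _ → 0ℤ) ≗ λ _ → 0ℤ
shift-0 zero    n       = refl
shift-0 (suc e) zero    = refl
shift-0 (suc e) (suc n) = shift-0 e n

shift-shift : ∀ d e f → shift d (shift e f) ≗ shift (d ℕ.+ e) f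
shift-shift zero    e f n       = refl
shift-shift (suc d) e f zero    = refl
shift-shift (suc d) e f (suc n) = shift-shift d e f n

q^-suc : ∀ e n → (q^ suc e) (suc n) ≡ (q^ e) n
q^-suc e n with suc n ℕ.≟ suc e | n ℕ.≟ e
... | yes _   | yes _   = refl
... | no  _   | no  _   = refl
... | yes n≡e | no  n≢e = contradiction (ℕ.suc-injective n≡e) n≢e
... | no  n≢e | yes n≡e = contradiction (cong suc n≡e) n≢e

q^-* : ∀ e f → q^ e * f ≗ shift e f
q^-* zero    f n       = *-identityˡ f n
q^-* (suc e) f zero    = refl
q^-* (suc e) f (suc n) = begin
  0ℤ ℤ.* f (suc n) ℤ.+ (((q^ suc e) ∘ suc) * f) n
    ≡⟨ ℤ.+-identityˡ _ ⟩
  (((q^ suc e) ∘ suc) * f) n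
    ≡⟨ *-congʳ f (q^-suc e) n ⟩
  (q^ e * f) n
    ≡⟨ q^-* e f n ⟩
  shift e f n ∎
  where open ≡-Reasoning

q^-^-* : ∀ s n f → (q^ s) ^ n * f ≗ shift (s ℕ.* n) f
q^-^-* s zero    f m rewrite ℕ.*-zeroʳ s = *-identityˡ f m
q^-^-* s (suc n) f m = begin
  ((q^ s) ^ n * q^ s * f) m      ≡⟨ *-assoc ((q^ s) ^ n) (q^ s) f m ⟩
  ((q^ s) ^ n * (q^ s * f)) m    ≡⟨ q^-^-* s n (q^ s * f) m ⟩
  shift (s ℕ.* n) (q^ s * f) m   ≡⟨ shift-cong (s ℕ.* n) (q^-* s f) m ⟩
  shift (s ℕ.* n) (shift s f) m  ≡⟨ shift-shift (s ℕ.* n) s f m ⟩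
  shift (s ℕ.* n ℕ.+ s) f m      ≡⟨ cong (λ e → shift e f m) s*n+s ⟩
  shift (s ℕ.* suc n) f m        ∎
  where
  open ≡-Reasoning
  s*n+s : s ℕ.* n ℕ.+ s ≡ s ℕ.* suc n
  s*n+s = trans (ℕ.+-comm _ s) (sym (ℕ.*-suc s n))

-- The last factor 1 - q^(s(n+1)) of (q^s;q^s)_(n+1).
⟨⨾⟩-factor : ℕ → ℕ → Series
⟨⨾⟩-factor s n = one - q^ s * (q^ s) ^ n

⟨⨾⟩-factor-* : ∀ s n f → ⟨⨾⟩-factor s n * f ≗ λ m → f m ℤ.- shift (s ℕ.* suc n) f m
⟨⨾⟩-factor-* s n f m = begin
  ((one - p) * f) m
    ≡⟨ *-distribʳ one (λ k → ℤ.- p k) f m ⟩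
  (one * f) m ℤ.+ ((λ k → ℤ.- p k) * f) m
    ≡⟨ cong₂ ℤ._+_ (*-identityˡ f m) -p*f ⟩
  f m ℤ.- (p * f) m
    ≡⟨ cong (λ u → f m ℤ.- u) p*f ⟩
  f m ℤ.- shift (s ℕ.* suc n) f m ∎
  where
  open ≡-Reasoning
  p : Series
  p = q^ s * (q^ s) ^ n
  -p*f : ((λ k → ℤ.- p k) * f) m ≡ ℤ.- (p * f) m
  -p*f = begin
    ((λ k → ℤ.- p k) * f) m             ≡⟨ *-congʳ f (λ k → ℤ.-1*i≡-i (p k)) m ⟨
    ((λ k → ℤ.-1ℤ ℤ.* p k) * f) m       ≡⟨ *-scaleˡ ℤ.-1ℤ p f m ⟩
    ℤ.-1ℤ ℤ.* (p * f) m                 ≡⟨ ℤ.-1*i≡-i _ ⟩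
    ℤ.- (p * f) m                       ∎
  p*f : (p * f) m ≡ shift (s ℕ.* suc n) f m
  p*f = trans (*-congʳ f (*-comm (q^ s) ((q^ s) ^ n)) m) (q^-^-* s (suc n) f m)

-- Reciprocals of the denominators

weight : ℕ → ℕ → ℕ → Series
weight i j k = recip (denominator i j k) (denominator-constant i j k)

-- Clearing the last factor gives (1 - q^(s(n+1))) w′ = w; moving the negative term across yields a
-- recurrence with additions only.
weight-step : ∀ s n i j k i′ j′ k′ →
  denominator i′ j′ k′ ≗ denominator i j k * ⟨⨾⟩-factor s n →
  ∀ m → weight i′ j′ k′ m ≡ shift (s ℕ.* suc n) (weight i′ j′ k′) m ℤ.+ weight i j k m
weight-step s n i j k i′ j′ k′ eq m =
  i-j≡k⇒i≡j+k _ _ (trans (sym (⟨⨾⟩-factor-* s n (weight i′ j′ k′) m))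
    (recip-factor (denominator i j k) (denominator i′ j′ k′) (denominator-constant i j k)
      (denominator-constant i′ j′ k′) (⟨⨾⟩-factor s n) eq m))
  where
  i-j≡k⇒i≡j+k : ∀ i j {k} → i ℤ.- j ≡ k → i ≡ j ℤ.+ k
  i-j≡k⇒i≡j+k i j refl = identity i j
    where
    identity : ∀ i j → i ≡ j ℤ.+ (i ℤ.- j)
    identity = ℤ-Solver.solve-∀

weight-i : ∀ i j k n → weight (suc i) j k n ≡
  shift (1 ℕ.* suc i) (weight (suc i) j k) n ℤ.+ weight i j k n
-- The new factor sits in the innermost product; two exchanges carry it past the other q-factorials
-- to the end.
weight-i i j k = weight-step 1 i i j k (suc i) j k λ n → trans
  (*-congʳ (⟨ q^ 3 ⨾ q^ 3 ⟩ k)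
    (xy∙z≈xz∙y (⟨ q^ 1 ⨾ q^ 1 ⟩ i) (⟨⨾⟩-factor 1 i) (⟨ q^ 2 ⨾ q^ 2 ⟩ j)) n)
  (xy∙z≈xz∙y (⟨ q^ 1 ⨾ q^ 1 ⟩ i * ⟨ q^ 2 ⨾ q^ 2 ⟩ j) (⟨⨾⟩-factor 1 i) (⟨ q^ 3 ⨾ q^ 3 ⟩ k) n)

weight-j : ∀ i j k n → weight i (suc j) k n ≡
  shift (2 ℕ.* suc j) (weight i (suc j) k) n ℤ.+ weight i j k n
weight-j i j k = weight-step 2 j i j k i (suc j) k λ n → trans
  (*-congʳ (⟨ q^ 3 ⨾ q^ 3 ⟩ k)
    (λ m → sym (*-assoc (⟨ q^ 1 ⨾ q^ 1 ⟩ i) (⟨ q^ 2 ⨾ q^ 2 ⟩ j) (⟨⨾⟩-factor 2 j) m)) n)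
  (xy∙z≈xz∙y (⟨ q^ 1 ⨾ q^ 1 ⟩ i * ⟨ q^ 2 ⨾ q^ 2 ⟩ j) (⟨⨾⟩-factor 2 j) (⟨ q^ 3 ⨾ q^ 3 ⟩ k) n)

weight-k : ∀ i j k n → weight i j (suc k) n ≡
  shift (3 ℕ.* suc k) (weight i j (suc k)) n ℤ.+ weight i j k n
weight-k i j k = weight-step 3 k i j k i j (suc k) λ n →
  sym (*-assoc (⟨ q^ 1 ⨾ q^ 1 ⟩ i * ⟨ q^ 2 ⨾ q^ 2 ⟩ j) (⟨ q^ 3 ⨾ q^ 3 ⟩ k) (⟨⨾⟩-factor 3 k) n)

weight-0 : weight 0 0 0 ≗ one
weight-0 n = sym (recip-unique (one * one * one) (denominator-constant 0 0 0) one one³*one n)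
  where
  one³*one : one * one * one * one ≗ one
  one³*one m = trans (*-assoc (one * one) one one m)
    (trans (*-cong (*-identityˡ one) (*-identityˡ one) m) (*-identityˡ one m))

-- Finite sums

∑< : ℕ → (ℕ → ℤ) → ℤ
∑< b f = foldr ℤ._+_ 0ℤ (applyUpTo f b)

∑<-cong : ∀ b {f g} → f ≗ g → ∑< b f ≡ ∑< b g
∑<-cong zero    f≗g = refl
∑<-cong (suc b) f≗g = cong₂ ℤ._+_ (f≗g 0) (∑<-cong b (f≗g ∘ suc))

∑<-zero : ∀ b {f} → (∀ i → f i ≡ 0ℤ) → ∑< b f ≡ 0ℤ
∑<-zero zero    f≗0 = refl
∑<-zero (suc b) f≗0 = cong₂ ℤ._+_ (f≗0 0) (∑<-zero b (f≗0 ∘ suc))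

∑<-distrib : ∀ b {f g h} → (∀ i → f i ≡ g i ℤ.+ h i) → ∑< b f ≡ ∑< b g ℤ.+ ∑< b h
∑<-distrib zero                f≗g+h = refl
∑<-distrib (suc b) {_} {g} {h} f≗g+h = trans
  (cong₂ ℤ._+_ (f≗g+h 0) (∑<-distrib b {_} {g ∘ suc} {h ∘ suc} (f≗g+h ∘ suc)))
  (interchange (g 0) (h 0) (∑< b (g ∘ suc)) (∑< b (h ∘ suc)))
  where
  interchange : ∀ s t u v → (s ℤ.+ t) ℤ.+ (u ℤ.+ v) ≡ (s ℤ.+ u) ℤ.+ (t ℤ.+ v)
  interchange = ℤ-Solver.solve-∀

∑<-distrib-suc : ∀ b f g h → f 0 ≡ g 0 → (∀ i → f (suc i) ≡ g (suc i) ℤ.+ h i) →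
  ∑< (suc b) f ≡ ∑< (suc b) g ℤ.+ ∑< b h
∑<-distrib-suc b f g h f₀≡g₀ f≗g+h = trans
  (cong₂ ℤ._+_ f₀≡g₀ (∑<-distrib b {_} {g ∘ suc} {h} f≗g+h))
  (sym (ℤ.+-assoc (g 0) (∑< b (g ∘ suc)) (∑< b h)))

∑<-restrict : ∀ {b b′ f} → b ℕ.≤ b′ → (∀ i → b ℕ.≤ i → f i ≡ 0ℤ) → ∑< b′ f ≡ ∑< b f
∑<-restrict {b′ = b′} z≤n         f≗0 = ∑<-zero b′ (λ i → f≗0 i z≤n)
∑<-restrict {f = f}   (s≤s b≤b′) f≗0 =
  cong (λ u → f 0 ℤ.+ u) (∑<-restrict b≤b′ (λ i b≤i → f≗0 (suc i) (s≤s b≤i)))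

∑<-shift : ∀ b e (f : ℕ → Series) n →
  ∑< b (λ i → shift e (f i) n) ≡ shift e (λ n′ → ∑< b (λ i → f i n′)) n
∑<-shift b zero    f n       = refl
∑<-shift b (suc e) f zero    = ∑<-zero b (λ _ → refl)
∑<-shift b (suc e) f (suc n) = ∑<-shift b e f n

∑box : ℕ → ℕ → ℕ → (ℕ → ℕ → ℕ → ℤ) → ℤ
∑box a b c f = ∑< a λ i → ∑< b λ j → ∑< c λ k → f i j k

-- The common shape of the three recurrences for S: raising a parameter does not affect the slice
-- with index 0, where that parameter is multiplied by 0. On the other slices the remainder `h` is
-- indexed by the predecessor, hence the box that is shorter by one.
∑box-sucˡ : ∀ a b c f g h → (∀ j k → f 0 j k ≡ g 0 j k) →
  (∀ i j k → f (suc i) j k ≡ g (suc i) j k ℤ.+ h i j k) →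
  ∑box (suc a) b c f ≡ ∑box (suc a) b c g ℤ.+ ∑box a b c h
∑box-sucˡ a b c f g h f₀≡g₀ f≗g+h = ∑<-distrib-suc a
  (λ i → ∑< b λ j → ∑< c λ k → f i j k)
  (λ i → ∑< b λ j → ∑< c λ k → g i j k)
  (λ i → ∑< b λ j → ∑< c λ k → h i j k)
  (∑<-cong b λ j → ∑<-cong c λ k → f₀≡g₀ j k)
  (λ i → ∑<-distrib b λ j → ∑<-distrib c λ k → f≗g+h i j k)

∑box-sucᵐ : ∀ a b c f g h → (∀ i k → f i 0 k ≡ g i 0 k) →
  (∀ i j k → f i (suc j) k ≡ g i (suc j) k ℤ.+ h i j k) →
  ∑box a (suc b) c f ≡ ∑box a (suc b) c g ℤ.+ ∑box a b c h
∑box-sucᵐ a b c f g h f₀≡g₀ f≗g+h = ∑<-distrib a λ i → ∑<-distrib-suc b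
  (λ j → ∑< c λ k → f i j k)
  (λ j → ∑< c λ k → g i j k)
  (λ j → ∑< c λ k → h i j k)
  (∑<-cong c λ k → f₀≡g₀ i k)
  (λ j → ∑<-distrib c λ k → f≗g+h i j k)

∑box-sucʳ : ∀ a b c f g h → (∀ i j → f i j 0 ≡ g i j 0) →
  (∀ i j k → f i j (suc k) ≡ g i j (suc k) ℤ.+ h i j k) →
  ∑box a b (suc c) f ≡ ∑box a b (suc c) g ℤ.+ ∑box a b c h
∑box-sucʳ a b c f g h f₀≡g₀ f≗g+h = ∑<-distrib a λ i → ∑<-distrib b λ j →
  ∑<-distrib-suc c (f i j) (g i j) (h i j) (f₀≡g₀ i j) (f≗g+h i j)

∑box-cong : ∀ a b c {f g} → (∀ i j k → f i j k ≡ g i j k) → ∑box a b c f ≡ ∑box a b c g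
∑box-cong a b c f≗g = ∑<-cong a λ i → ∑<-cong b λ j → ∑<-cong c λ k → f≗g i j k

∑box-restrict : ∀ {a b c d f} → d ℕ.≤ a → d ℕ.≤ b → d ℕ.≤ c →
  (∀ i j k → d ℕ.≤ i ⊎ d ℕ.≤ j ⊎ d ℕ.≤ k → f i j k ≡ 0ℤ) →
  ∑box a b c f ≡ ∑box d d d f
∑box-restrict {a} {b} {c} {d} d≤a d≤b d≤c f≗0 = trans
  (∑<-restrict d≤a λ i d≤i → ∑<-zero b λ j → ∑<-zero c λ k → f≗0 i j k (inj₁ d≤i))
  (∑<-cong d λ i → trans
    (∑<-restrict d≤b λ j d≤j → ∑<-zero c λ k → f≗0 i j k (inj₂ (inj₁ d≤j)))
    (∑<-cong d λ j → ∑<-restrict d≤c λ k d≤k → f≗0 i j k (inj₂ (inj₂ d≤k))))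

∑box-shift : ∀ a b c e (f : ℕ → ℕ → ℕ → Series) n →
  ∑box a b c (λ i j k → shift e (f i j k) n) ≡
  shift e (λ n′ → ∑box a b c (λ i j k → f i j k n′)) n
∑box-shift a b c e f n = trans
  (∑<-cong a λ i → trans
    (∑<-cong b λ j → ∑<-shift c e (f i j) n)
    (∑<-shift b e (λ j n′ → ∑< c (λ k → f i j k n′)) n))
  (∑<-shift a e (λ i n′ → ∑< b (λ j → ∑< c (λ k → f i j k n′))) n)

-- Bivariate monomials

-- Multiplication by x^d q^e.
shift₂ : ℕ → ℕ → Series₂ → Series₂
shift₂ d e F m n = shift d (λ m′ → shift e (F m′) n) m

shift-cong-≤ : ∀ e {f g} n → (∀ n′ → n′ ℕ.≤ n → f n′ ≡ g n′) → shift e f n ≡ shift e g n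
shift-cong-≤ zero    n       f≗g = f≗g n ℕ.≤-refl
shift-cong-≤ (suc e) zero    f≗g = refl
shift-cong-≤ (suc e) (suc n) f≗g = shift-cong-≤ e n (λ n′ n′≤n → f≗g n′ (ℕ.m≤n⇒m≤1+n n′≤n))

-- Only rows `m′ ≤ m` enter row `m` of the product. The bound matters for the multisums, whose boxes
-- of summation depend on the row.
shift₂-cong-≤ : ∀ d e {F G} m n → (∀ m′ → m′ ℕ.≤ m → F m′ ≗ G m′) →
  shift₂ d e F m n ≡ shift₂ d e G m n
shift₂-cong-≤ d e m n F≗G = shift-cong-≤ d m (λ m′ m′≤m → shift-cong e (F≗G m′ m′≤m) n)

shift₂-cong : ∀ d e {F G} m n → (∀ m′ → F m′ ≗ G m′) → shift₂ d e F m n ≡ shift₂ d e G m n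
shift₂-cong d e m n F≗G = shift₂-cong-≤ d e m n (λ m′ _ → F≗G m′)

shift₂-+ : ∀ d e F G m n →
  shift₂ d e (λ m′ n′ → F m′ n′ ℤ.+ G m′ n′) m n ≡ shift₂ d e F m n ℤ.+ shift₂ d e G m n
shift₂-+ d e F G m n = trans
  (shift-cong d (λ m′ → shift-+ e (F m′) (G m′) n) m)
  (shift-+ d (λ m′ → shift e (F m′) n) (λ m′ → shift e (G m′) n) m)

shift₂-shift₂ : ∀ d e d′ e′ F m n →
  shift₂ d e (shift₂ d′ e′ F) m n ≡ shift₂ (d ℕ.+ d′) (e ℕ.+ e′) F m n
shift₂-shift₂ d e d′ e′ F m n = trans (shift-cong d inner m) (shift-shift d d′ _ m)
  where
  commute : ∀ d e (G : Series₂) m →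
    shift e (λ n′ → shift d (λ m′ → G m′ n′) m) n ≡ shift d (λ m′ → shift e (G m′) n) m
  commute zero    e G m       = refl
  commute (suc d) e G zero    = shift-0 e n
  commute (suc d) e G (suc m) = commute d e G m
  inner : ∀ m′ → shift e (shift₂ d′ e′ F m′) n ≡ shift d′ (λ m″ → shift (e ℕ.+ e′) (F m″) n) m′
  inner m′ = trans (commute d′ e (λ m″ → shift e′ (F m″)) m′)
    (shift-cong d′ (λ m″ → shift-shift e e′ (F m″) n) m′)

∑box-shift₂ : ∀ a b c d e (F : ℕ → ℕ → ℕ → Series₂) m n →
  ∑box a b c (λ i j k → shift₂ d e (F i j k) m n) ≡
  shift₂ d e (λ m′ n′ → ∑box a b c (λ i j k → F i j k m′ n′)) m n
∑box-shift₂ a b c d e F m n = trans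
  (∑box-shift a b c d (λ i j k m′ → shift e (F i j k m′) n) m)
  (shift-cong d (λ m′ → ∑box-shift a b c e (λ i j k → F i j k m′) n) m)

x^∙-cong : ∀ N {f g} → f ≗ g → ∀ m → (x^ N ∙ f) m ≗ (x^ N ∙ g) m
x^∙-cong N f≗g m n with m ℕ.≟ N
... | yes _ = f≗g n
... | no  _ = refl

x^∙-+ : ∀ N f g m n →
  (x^ N ∙ λ n′ → f n′ ℤ.+ g n′) m n ≡ (x^ N ∙ f) m n ℤ.+ (x^ N ∙ g) m n
x^∙-+ N f g m n with m ℕ.≟ N
... | yes _ = refl
... | no  _ = refl

x^∙-≢ : ∀ {N m} f n → m ≢ N → (x^ N ∙ f) m n ≡ 0ℤ
x^∙-≢ {N} {m} f n m≢N with m ℕ.≟ N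
... | yes m≡N = contradiction m≡N m≢N
... | no  _   = refl

x^∙-shift₂ : ∀ d N e f m n → (x^ (d ℕ.+ N) ∙ shift e f) m n ≡ shift₂ d e (x^ N ∙ f) m n
x^∙-shift₂ zero N e f m n with m ℕ.≟ N
... | yes _ = refl
... | no  _ = sym (shift-0 e n)
x^∙-shift₂ (suc d) N e f zero    n = refl
x^∙-shift₂ (suc d) N e f (suc m) n = trans x^-suc (x^∙-shift₂ d N e f m n)
  where
  x^-suc : (x^ suc (d ℕ.+ N) ∙ shift e f) (suc m) n ≡ (x^ (d ℕ.+ N) ∙ shift e f) m n
  x^-suc with suc m ℕ.≟ suc (d ℕ.+ N) | m ℕ.≟ d ℕ.+ N
  ... | yes _   | yes _   = refl
  ... | no  _   | no  _   = refl
  ... | yes m≡N | no  m≢N = contradiction (ℕ.suc-injective m≡N) m≢N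
  ... | no  m≢N | yes m≡N = contradiction (cong suc m≡N) m≢N

-- The multisums

-- N(N-1)/2 without division, so that increasing N unfolds definitionally.
triangle : ℕ → ℕ
triangle zero    = 0
triangle (suc n) = n ℕ.+ triangle n

triangle-formula : ∀ n → (n ℕ.* (n ℕ.∸ 1)) ℕ./ 2 ≡ triangle n
triangle-formula n = trans (cong (ℕ._/ 2) (twice n)) (ℕ.m*n/n≡m (triangle n) 2)
  where
  twice : ∀ n → n ℕ.* (n ℕ.∸ 1) ≡ triangle n ℕ.* 2
  twice zero          = refl
  twice (suc zero)    = refl
  twice (suc (suc n)) = trans (expand n)
    (trans (cong (λ u → 2 ℕ.* suc n ℕ.+ u) (twice (suc n))) (collect n (triangle (suc n))))
    where
    expand : ∀ n → suc (suc n) ℕ.* suc n ≡ 2 ℕ.* suc n ℕ.+ suc n ℕ.* n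
    expand = ℕ-Solver.solve-∀
    collect : ∀ n t → 2 ℕ.* suc n ℕ.+ t ℕ.* 2 ≡ (suc n ℕ.+ t) ℕ.* 2
    collect = ℕ-Solver.solve-∀

size : ℕ → ℕ → ℕ → ℕ
size i j k = i ℕ.+ 2 ℕ.* j ℕ.+ 3 ℕ.* k

size≥ : ∀ {d} i j k → d ℕ.≤ i ⊎ d ℕ.≤ j ⊎ d ℕ.≤ k → d ℕ.≤ size i j k
size≥ i j k (inj₁ d≤i) = ℕ.m≤n⇒m≤n+o (3 ℕ.* k) (ℕ.m≤n⇒m≤n+o (2 ℕ.* j) d≤i)
size≥ i j k (inj₂ (inj₁ d≤j)) =
  ℕ.m≤n⇒m≤n+o (3 ℕ.* k) (ℕ.m≤n⇒m≤o+n i (ℕ.m≤n⇒m≤n+o (j ℕ.+ 0) d≤j))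
size≥ i j k (inj₂ (inj₂ d≤k)) = ℕ.m≤n⇒m≤o+n (i ℕ.+ 2 ℕ.* j) (ℕ.m≤n⇒m≤n+o _ d≤k)

exponent : ℕ → ℕ → ℕ → ℕ → ℕ → ℕ → ℕ
exponent a b c i j k =
  triangle (size i j k) ℕ.+ (a ℕ.* i ℕ.+ (j ℕ.* j ℕ.+ b ℕ.* j) ℕ.+ c ℕ.* k)

term : ℕ → ℕ → ℕ → ℕ → ℕ → ℕ → Series₂
term a b c i j k = x^ size i j k ∙ shift (exponent a b c i j k) (weight i j k)

-- The recurrence of the weight splits a term in two: the part with `shift s` keeps the indices and
-- raises a parameter of the exponent, while the other part has one index lowered, which frees the
-- monomial x^d q^δ.
term-step : ∀ d δ {N′ N e′ e″ e s w′ w} → (∀ n → w′ n ≡ shift s w′ n ℤ.+ w n) →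
  N′ ≡ d ℕ.+ N → e″ ≡ e′ ℕ.+ s → e′ ≡ δ ℕ.+ e → ∀ m n →
  (x^ N′ ∙ shift e′ w′) m n ≡
  (x^ N′ ∙ shift e″ w′) m n ℤ.+ shift₂ d δ (x^ N ∙ shift e w) m n
term-step d δ {N′} {N} {e′} {_} {e} {s} {w′} {w} w-step N′≡ refl e′≡ m n = begin
  (x^ N′ ∙ shift e′ w′) m n
    ≡⟨ x^∙-cong N′ split m n ⟩
  (x^ N′ ∙ λ n′ → shift (e′ ℕ.+ s) w′ n′ ℤ.+ shift e′ w n′) m n
    ≡⟨ x^∙-+ N′ (shift (e′ ℕ.+ s) w′) (shift e′ w) m n ⟩
  (x^ N′ ∙ shift (e′ ℕ.+ s) w′) m n ℤ.+ (x^ N′ ∙ shift e′ w) m n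
    ≡⟨ cong (λ u → (x^ N′ ∙ shift (e′ ℕ.+ s) w′) m n ℤ.+ u) rest ⟩
  (x^ N′ ∙ shift (e′ ℕ.+ s) w′) m n ℤ.+ shift₂ d δ (x^ N ∙ shift e w) m n ∎
  where
  open ≡-Reasoning
  split : shift e′ w′ ≗ λ n′ → shift (e′ ℕ.+ s) w′ n′ ℤ.+ shift e′ w n′
  split n′ = trans (shift-cong e′ w-step n′)
    (trans (shift-+ e′ (shift s w′) w n′)
      (cong (ℤ._+ shift e′ w n′) (shift-shift e′ s w′ n′)))
  rest : (x^ N′ ∙ shift e′ w) m n ≡ shift₂ d δ (x^ N ∙ shift e w) m n
  rest rewrite N′≡ | e′≡ = trans
    (x^∙-cong (d ℕ.+ N) (λ n′ → sym (shift-shift δ e w n′)) m n)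
    (x^∙-shift₂ d N δ (shift e w) m n)

-- S(a,b,c); as N ≥ i, j, k, the coefficient of x^m only involves terms with i, j, k ≤ m.
multisum : ℕ → ℕ → ℕ → Series₂
multisum a b c m n = ∑box (suc m) (suc m) (suc m) (λ i j k → term a b c i j k m n)

term-vanishes : ∀ a b c {m} i j k n → suc m ℕ.≤ i ⊎ suc m ℕ.≤ j ⊎ suc m ℕ.≤ k →
  term a b c i j k m n ≡ 0ℤ
term-vanishes a b c i j k n m< =
  x^∙-≢ (shift (exponent a b c i j k) (weight i j k)) n (ℕ.<⇒≢ (size≥ i j k m<))

multisum-restrict : ∀ a b c m n {p q r} → m ℕ.< p → m ℕ.< q → m ℕ.< r →
  ∑box p q r (λ i j k → term a b c i j k m n) ≡ multisum a b c m n
multisum-restrict a b c m n m<p m<q m<r =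
  ∑box-restrict m<p m<q m<r λ i j k → term-vanishes a b c i j k n

multisum-shift₂ : ∀ a b c d e m n →
  ∑box (suc m) (suc m) (suc m) (λ i j k → shift₂ d e (term a b c i j k) m n) ≡
  shift₂ d e (multisum a b c) m n
multisum-shift₂ a b c d e m n = trans
  (∑box-shift₂ (suc m) (suc m) (suc m) d e (term a b c) m n)
  (shift₂-cong-≤ d e m n λ m′ m′≤m n′ →
    multisum-restrict a b c m′ n′ (s≤s m′≤m) (s≤s m′≤m) (s≤s m′≤m))

-- Replacing i by i+1 raises N to N+1, and N(N-1)/2 grows by N = i + 2j + 3k. This raises the
-- parameters by 1, 2, 3, and a(i+1) leaves the factor q^a.
multisum-i : ∀ a b c m n → multisum a b c m n ≡
  multisum (1 ℕ.+ a) b c m n ℤ.+ shift₂ 1 a (multisum (1 ℕ.+ a) (2 ℕ.+ b) (3 ℕ.+ c)) m n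
multisum-i a b c m n = begin
  multisum a b c m n
    -- The box gets one extra value of i, whose terms vanish, so that after i is lowered the
    -- remainder runs over the standard box.
    ≡⟨ multisum-restrict a b c m n (ℕ.m<n⇒m<1+n (ℕ.n<1+n m)) ℕ.≤-refl ℕ.≤-refl ⟨
  ∑box (2 ℕ.+ m) (suc m) (suc m) f
    ≡⟨ ∑box-sucˡ (suc m) (suc m) (suc m) f g h (λ _ _ → refl) step ⟩
  ∑box (2 ℕ.+ m) (suc m) (suc m) g ℤ.+ ∑box (suc m) (suc m) (suc m) h
    ≡⟨ cong₂ ℤ._+_
         (multisum-restrict (1 ℕ.+ a) b c m n (ℕ.m<n⇒m<1+n (ℕ.n<1+n m)) ℕ.≤-refl ℕ.≤-refl)
         (multisum-shift₂ (1 ℕ.+ a) (2 ℕ.+ b) (3 ℕ.+ c) 1 a m n) ⟩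
  multisum (1 ℕ.+ a) b c m n ℤ.+ shift₂ 1 a (multisum (1 ℕ.+ a) (2 ℕ.+ b) (3 ℕ.+ c)) m n ∎
  where
  open ≡-Reasoning
  f g h : ℕ → ℕ → ℕ → ℤ
  f i j k = term a b c i j k m n
  g i j k = term (1 ℕ.+ a) b c i j k m n
  h i j k = shift₂ 1 a (term (1 ℕ.+ a) (2 ℕ.+ b) (3 ℕ.+ c) i j k) m n
  step : ∀ i j k → f (suc i) j k ≡ g (suc i) j k ℤ.+ h i j k
  step i j k = term-step 1 a (weight-i i j k) refl
    (eq₁ a b c i j k (triangle (size (suc i) j k))) (eq₂ a b c i j k (triangle (size i j k))) m n
    where
    eq₁ : ∀ a b c i j k t →
      t ℕ.+ ((1 ℕ.+ a) ℕ.* suc i ℕ.+ (j ℕ.* j ℕ.+ b ℕ.* j) ℕ.+ c ℕ.* k) ≡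
      t ℕ.+ (a ℕ.* suc i ℕ.+ (j ℕ.* j ℕ.+ b ℕ.* j) ℕ.+ c ℕ.* k) ℕ.+ 1 ℕ.* suc i
    eq₁ = ℕ-Solver.solve-∀
    eq₂ : ∀ a b c i j k t →
      (i ℕ.+ 2 ℕ.* j ℕ.+ 3 ℕ.* k ℕ.+ t) ℕ.+ (a ℕ.* suc i ℕ.+ (j ℕ.* j ℕ.+ b ℕ.* j) ℕ.+ c ℕ.* k) ≡
      a ℕ.+ (t ℕ.+ ((1 ℕ.+ a) ℕ.* i ℕ.+ (j ℕ.* j ℕ.+ (2 ℕ.+ b) ℕ.* j) ℕ.+ (3 ℕ.+ c) ℕ.* k))
    eq₂ = ℕ-Solver.solve-∀

-- For j+1 the triangular number grows by 2N + 1 and j² by 2j + 1. Together with b(j+1) the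
-- constants give q^(b+2), and the parameter of j grows by 4 + 2.
multisum-j : ∀ a b c m n → multisum a b c m n ≡
  multisum a (2 ℕ.+ b) c m n ℤ.+
  shift₂ 2 (2 ℕ.+ b) (multisum (2 ℕ.+ a) (6 ℕ.+ b) (6 ℕ.+ c)) m n
multisum-j a b c m n = begin
  multisum a b c m n
    ≡⟨ multisum-restrict a b c m n ℕ.≤-refl (ℕ.m<n⇒m<1+n (ℕ.n<1+n m)) ℕ.≤-refl ⟨
  ∑box (suc m) (2 ℕ.+ m) (suc m) f
    ≡⟨ ∑box-sucᵐ (suc m) (suc m) (suc m) f g h (λ _ _ → refl) step ⟩
  ∑box (suc m) (2 ℕ.+ m) (suc m) g ℤ.+ ∑box (suc m) (suc m) (suc m) h
    ≡⟨ cong₂ ℤ._+_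
         (multisum-restrict a (2 ℕ.+ b) c m n ℕ.≤-refl (ℕ.m<n⇒m<1+n (ℕ.n<1+n m)) ℕ.≤-refl)
         (multisum-shift₂ (2 ℕ.+ a) (6 ℕ.+ b) (6 ℕ.+ c) 2 (2 ℕ.+ b) m n) ⟩
  multisum a (2 ℕ.+ b) c m n ℤ.+
  shift₂ 2 (2 ℕ.+ b) (multisum (2 ℕ.+ a) (6 ℕ.+ b) (6 ℕ.+ c)) m n ∎
  where
  open ≡-Reasoning
  f g h : ℕ → ℕ → ℕ → ℤ
  f i j k = term a b c i j k m n
  g i j k = term a (2 ℕ.+ b) c i j k m n
  h i j k = shift₂ 2 (2 ℕ.+ b) (term (2 ℕ.+ a) (6 ℕ.+ b) (6 ℕ.+ c) i j k) m n
  step : ∀ i j k → f i (suc j) k ≡ g i (suc j) k ℤ.+ h i j k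
  step i j k = term-step 2 (2 ℕ.+ b) (weight-j i j k) size-suc
    (eq₁ a b c i j k (triangle (size i (suc j) k)))
    -- The size does not compute to a successor here, so `triangle` unfolds only after it is
    -- rewritten to `2 + size i j k`.
    (trans (cong (ℕ._+ rest) (cong triangle size-suc)) (eq₂ a b c i j k (triangle (size i j k)))) m n
    where
    rest : ℕ
    rest = a ℕ.* i ℕ.+ (suc j ℕ.* suc j ℕ.+ b ℕ.* suc j) ℕ.+ c ℕ.* k
    size-suc : size i (suc j) k ≡ 2 ℕ.+ size i j k
    size-suc = identity i j k
      where
      identity : ∀ i j k → i ℕ.+ 2 ℕ.* suc j ℕ.+ 3 ℕ.* k ≡ 2 ℕ.+ (i ℕ.+ 2 ℕ.* j ℕ.+ 3 ℕ.* k)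
      identity = ℕ-Solver.solve-∀
    eq₁ : ∀ a b c i j k t →
      t ℕ.+ (a ℕ.* i ℕ.+ (suc j ℕ.* suc j ℕ.+ (2 ℕ.+ b) ℕ.* suc j) ℕ.+ c ℕ.* k) ≡
      t ℕ.+ (a ℕ.* i ℕ.+ (suc j ℕ.* suc j ℕ.+ b ℕ.* suc j) ℕ.+ c ℕ.* k) ℕ.+ 2 ℕ.* suc j
    eq₁ = ℕ-Solver.solve-∀
    eq₂ : ∀ a b c i j k t →
      let N = i ℕ.+ 2 ℕ.* j ℕ.+ 3 ℕ.* k in
      (suc N ℕ.+ (N ℕ.+ t)) ℕ.+
        (a ℕ.* i ℕ.+ (suc j ℕ.* suc j ℕ.+ b ℕ.* suc j) ℕ.+ c ℕ.* k) ≡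
      2 ℕ.+ b ℕ.+ (t ℕ.+
        ((2 ℕ.+ a) ℕ.* i ℕ.+ (j ℕ.* j ℕ.+ (6 ℕ.+ b) ℕ.* j) ℕ.+ (6 ℕ.+ c) ℕ.* k))
    eq₂ = ℕ-Solver.solve-∀

-- For k+1 the triangular number grows by 3N + 3, which gives q^(c+3) and raises the parameters by
-- 3, 6, 9.
multisum-k : ∀ a b c m n → multisum a b c m n ≡
  multisum a b (3 ℕ.+ c) m n ℤ.+
  shift₂ 3 (3 ℕ.+ c) (multisum (3 ℕ.+ a) (6 ℕ.+ b) (9 ℕ.+ c)) m n
multisum-k a b c m n = begin
  multisum a b c m n
    ≡⟨ multisum-restrict a b c m n ℕ.≤-refl ℕ.≤-refl (ℕ.m<n⇒m<1+n (ℕ.n<1+n m)) ⟨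
  ∑box (suc m) (suc m) (2 ℕ.+ m) f
    ≡⟨ ∑box-sucʳ (suc m) (suc m) (suc m) f g h (λ _ _ → refl) step ⟩
  ∑box (suc m) (suc m) (2 ℕ.+ m) g ℤ.+ ∑box (suc m) (suc m) (suc m) h
    ≡⟨ cong₂ ℤ._+_
         (multisum-restrict a b (3 ℕ.+ c) m n ℕ.≤-refl ℕ.≤-refl (ℕ.m<n⇒m<1+n (ℕ.n<1+n m)))
         (multisum-shift₂ (3 ℕ.+ a) (6 ℕ.+ b) (9 ℕ.+ c) 3 (3 ℕ.+ c) m n) ⟩
  multisum a b (3 ℕ.+ c) m n ℤ.+
  shift₂ 3 (3 ℕ.+ c) (multisum (3 ℕ.+ a) (6 ℕ.+ b) (9 ℕ.+ c)) m n ∎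
  where
  open ≡-Reasoning
  f g h : ℕ → ℕ → ℕ → ℤ
  f i j k = term a b c i j k m n
  g i j k = term a b (3 ℕ.+ c) i j k m n
  h i j k = shift₂ 3 (3 ℕ.+ c) (term (3 ℕ.+ a) (6 ℕ.+ b) (9 ℕ.+ c) i j k) m n
  step : ∀ i j k → f i j (suc k) ≡ g i j (suc k) ℤ.+ h i j k
  step i j k = term-step 3 (3 ℕ.+ c) (weight-k i j k) size-suc
    (eq₁ a b c i j k (triangle (size i j (suc k))))
    (trans (cong (ℕ._+ rest) (cong triangle size-suc)) (eq₂ a b c i j k (triangle (size i j k)))) m n
    where
    rest : ℕ
    rest = a ℕ.* i ℕ.+ (j ℕ.* j ℕ.+ b ℕ.* j) ℕ.+ c ℕ.* suc k
    size-suc : size i j (suc k) ≡ 3 ℕ.+ size i j k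
    size-suc = identity i j k
      where
      identity : ∀ i j k → i ℕ.+ 2 ℕ.* j ℕ.+ 3 ℕ.* suc k ≡ 3 ℕ.+ (i ℕ.+ 2 ℕ.* j ℕ.+ 3 ℕ.* k)
      identity = ℕ-Solver.solve-∀
    eq₁ : ∀ a b c i j k t →
      t ℕ.+ (a ℕ.* i ℕ.+ (j ℕ.* j ℕ.+ b ℕ.* j) ℕ.+ (3 ℕ.+ c) ℕ.* suc k) ≡
      t ℕ.+ (a ℕ.* i ℕ.+ (j ℕ.* j ℕ.+ b ℕ.* j) ℕ.+ c ℕ.* suc k) ℕ.+ 3 ℕ.* suc k
    eq₁ = ℕ-Solver.solve-∀
    eq₂ : ∀ a b c i j k t →
      let N = i ℕ.+ 2 ℕ.* j ℕ.+ 3 ℕ.* k in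
      (suc (suc N) ℕ.+ (suc N ℕ.+ (N ℕ.+ t))) ℕ.+
        (a ℕ.* i ℕ.+ (j ℕ.* j ℕ.+ b ℕ.* j) ℕ.+ c ℕ.* suc k) ≡
      3 ℕ.+ c ℕ.+ (t ℕ.+
        ((3 ℕ.+ a) ℕ.* i ℕ.+ (j ℕ.* j ℕ.+ (6 ℕ.+ b) ℕ.* j) ℕ.+ (9 ℕ.+ c) ℕ.* k))
    eq₂ = ℕ-Solver.solve-∀

-- The substitution x ↦ x q^t multiplies the coefficient of x^m by q^(tm). Only terms with N = m
-- contribute to it, and there tm = ti + 2tj + 3tk is absorbed by the three parameters.
multisum-twist : ∀ t a b c m n →
  multisum (t ℕ.+ a) (2 ℕ.* t ℕ.+ b) (3 ℕ.* t ℕ.+ c) m n ≡ shift (t ℕ.* m) (multisum a b c m) n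
multisum-twist t a b c m n = trans
  (∑box-cong (suc m) (suc m) (suc m) termwise)
  (∑box-shift (suc m) (suc m) (suc m) (t ℕ.* m) (λ i j k → term a b c i j k m) n)
  where
  exponent-twist : ∀ t a b c i j k T →
    T ℕ.+ ((t ℕ.+ a) ℕ.* i ℕ.+ (j ℕ.* j ℕ.+ (2 ℕ.* t ℕ.+ b) ℕ.* j) ℕ.+ (3 ℕ.* t ℕ.+ c) ℕ.* k) ≡
    t ℕ.* (i ℕ.+ 2 ℕ.* j ℕ.+ 3 ℕ.* k) ℕ.+
      (T ℕ.+ (a ℕ.* i ℕ.+ (j ℕ.* j ℕ.+ b ℕ.* j) ℕ.+ c ℕ.* k))
  exponent-twist = ℕ-Solver.solve-∀
  termwise : ∀ i j k → term (t ℕ.+ a) (2 ℕ.* t ℕ.+ b) (3 ℕ.* t ℕ.+ c) i j k m n ≡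
    shift (t ℕ.* m) (term a b c i j k m) n
  termwise i j k with m ℕ.≟ size i j k
  ... | no  _    = sym (shift-0 (t ℕ.* m) n)
  ... | yes refl = trans
    (cong (λ e → shift e (weight i j k) n) (exponent-twist t a b c i j k (triangle (size i j k))))
    (sym (shift-shift (t ℕ.* size i j k) (exponent a b c i j k) (weight i j k) n))

-- The triple series as a formal sum

sumℤ : List ℤ → ℤ
sumℤ = foldr ℤ._+_ 0ℤ

sumℤ-++ : ∀ us vs → sumℤ (us ++ vs) ≡ sumℤ us ℤ.+ sumℤ vs
sumℤ-++ []       vs = sym (ℤ.+-identityˡ _)
sumℤ-++ (u ∷ us) vs = trans (cong (λ s → u ℤ.+ s) (sumℤ-++ us vs)) (sym (ℤ.+-assoc u _ _))

sumℤ-cartesianProduct : ∀ {A B : Set} (f : A × B → ℤ) xs ys →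
  sumℤ (map f (cartesianProduct xs ys)) ≡
  sumℤ (map (λ x → sumℤ (map (λ y → f (x , y)) ys)) xs)
sumℤ-cartesianProduct f []       ys = refl
sumℤ-cartesianProduct f (x ∷ xs) ys = begin
  sumℤ (map f (map (x ,_) ys ++ cartesianProduct xs ys))
    ≡⟨ cong sumℤ (List.map-++ f (map (x ,_) ys) _) ⟩
  sumℤ (map f (map (x ,_) ys) ++ map f (cartesianProduct xs ys))
    ≡⟨ sumℤ-++ (map f (map (x ,_) ys)) _ ⟩
  sumℤ (map f (map (x ,_) ys)) ℤ.+ sumℤ (map f (cartesianProduct xs ys))
    ≡⟨ cong₂ ℤ._+_ (cong sumℤ (sym (List.map-∘ ys))) (sumℤ-cartesianProduct f xs ys) ⟩
  sumℤ (map (λ y → f (x , y)) ys) ℤ.+ sumℤ (map (λ x → sumℤ (map (λ y → f (x , y)) ys)) xs) ∎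
  where open ≡-Reasoning

sumℤ-upTo : ∀ b f → sumℤ (map f (upTo b)) ≡ ∑< b f
sumℤ-upTo b f = cong sumℤ (List.map-upTo f b)

cube : ℕ → List (ℕ × ℕ × ℕ)
cube b = cartesianProduct (upTo b) (cartesianProduct (upTo b) (upTo b))

sumℤ-cube : ∀ b (f : ℕ × ℕ × ℕ → ℤ) →
  sumℤ (map f (cube b)) ≡ ∑box b b b (λ i j k → f (i , j , k))
sumℤ-cube b f = trans
  (sumℤ-cartesianProduct f (upTo b) (cartesianProduct (upTo b) (upTo b)))
  (trans (sumℤ-upTo b _) (∑<-cong b λ i → trans
    (sumℤ-cartesianProduct (λ p → f (i , p)) (upTo b) (upTo b))
    (trans (sumℤ-upTo b _) (∑<-cong b λ j → sumℤ-upTo b (λ k → f (i , j , k))))))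

-- The given summands are those of S(1,2,4), once the division by 2 is replaced by `triangle`.
multisumTerm-term : ∀ i j k m → multisumTerm (i , j , k) m ≗ term 1 2 4 i j k m
multisumTerm-term i j k = x^∙-cong (size i j k) λ n → trans
  (q^-* ((N ℕ.* (N ℕ.∸ 1)) ℕ./ 2 ℕ.+ i ℕ.+ j ℕ.^ 2 ℕ.+ 2 ℕ.* j ℕ.+ 4 ℕ.* k) (weight i j k) n)
  (cong (λ e → shift e (weight i j k) n)
    (trans (cong (λ T → T ℕ.+ i ℕ.+ j ℕ.^ 2 ℕ.+ 2 ℕ.* j ℕ.+ 4 ℕ.* k) (triangle-formula N))
      (rearrange i j k (triangle N))))
  where
  N : ℕ
  N = size i j k
  rearrange : ∀ i j k T → T ℕ.+ i ℕ.+ j ℕ.* (j ℕ.* 1) ℕ.+ 2 ℕ.* j ℕ.+ 4 ℕ.* k ≡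
    T ℕ.+ (1 ℕ.* i ℕ.+ (j ℕ.* j ℕ.+ 2 ℕ.* j) ℕ.+ 4 ℕ.* k)
  rearrange = ℕ-Solver.solve-∀

multisumTerm-hasSum : HasSum U multisumTerm (multisum 1 2 4)
multisumTerm-hasSum m n =
  -- Since N is at least i, j and k, a triple with an index above m cannot contribute to x^m.
  cube (suc m) ,
  Unique.cartesianProduct⁺ (Unique.upTo⁺ (suc m))
    (Unique.cartesianProduct⁺ (Unique.upTo⁺ (suc m)) (Unique.upTo⁺ (suc m))) ,
  All.universal (λ _ → tt) (cube (suc m)) ,
  outside ,
  trans (sumℤ-cube (suc m) (λ t → multisumTerm t m n))
    (∑box-cong (suc m) (suc m) (suc m) λ i j k → multisumTerm-term i j k m n)
  where
  outside : ∀ t → U t → t ∉ cube (suc m) → multisumTerm t m n ≡ 0ℤ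
  outside (i , j , k) _ t∉ = trans (multisumTerm-term i j k m n)
    (term-vanishes 1 2 4 i j k n big)
    where
    big : suc m ℕ.≤ i ⊎ suc m ℕ.≤ j ⊎ suc m ℕ.≤ k
    big with suc m ℕ.≤? i | suc m ℕ.≤? j | suc m ℕ.≤? k
    ... | yes m<i | _       | _       = inj₁ m<i
    ... | no  _   | yes m<j | _       = inj₂ (inj₁ m<j)
    ... | no  _   | no  _   | yes m<k = inj₂ (inj₂ m<k)
    ... | no  m≮i | no  m≮j | no  m≮k = contradiction
      (∈-cartesianProduct⁺ (∈-upTo⁺ (ℕ.≰⇒> m≮i))
        (∈-cartesianProduct⁺ (∈-upTo⁺ (ℕ.≰⇒> m≮j)) (∈-upTo⁺ (ℕ.≰⇒> m≮k)))) t∉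

-- The q-difference equations of the multisums

-- The substitution x ↦ x q^t.
twisted : ℕ → Series₂ → Series₂
twisted t F m = shift (t ℕ.* m) (F m)

-- The i-recurrence at (1,2,4) produces S(2,2,4) and S(2,4,7), which are twists by 1 of S(1,0,1) and
-- S(1,2,4). The trivial `shift₂ 0 0` keeps the shape of `counts-extended` with empty prefix.
multisum-124 : ∀ m n → multisum 1 2 4 m n ≡
  shift₂ 0 0 (twisted 1 (multisum 1 0 1)) m n ℤ.+ shift₂ 1 1 (twisted 1 (multisum 1 2 4)) m n
multisum-124 m n = trans (multisum-i 1 2 4 m n) (cong₂ ℤ._+_
  (multisum-twist 1 1 0 1 m n)
  (shift₂-cong 1 1 m n (multisum-twist 1 1 2 4)))

-- The j- and k-recurrences lead to S(1,2,4), S(4,8,10) and S(3,6,7). Expanding S(3,6,7) in k leaves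
-- a term x⁵ q¹² S(6,12,16), which the j-recurrence read backwards merges with x³ q⁴ S(4,8,10) into
-- x³ q⁴ S(4,6,10), a twist of S(1,0,1).
multisum-101 : ∀ m n → multisum 1 0 1 m n ≡ multisum 1 2 4 m n ℤ.+
  (shift₂ 2 2 (twisted 2 (multisum 1 2 4)) m n ℤ.+ shift₂ 3 4 (twisted 3 (multisum 1 0 1)) m n)
multisum-101 m n = begin
  multisum 1 0 1 m n
    ≡⟨ multisum-j 1 0 1 m n ⟩
  multisum 1 2 1 m n ℤ.+ shift₂ 2 2 (multisum 3 6 7) m n
    ≡⟨ cong₂ ℤ._+_ (multisum-k 1 2 1 m n) expand ⟩
  (multisum 1 2 4 m n ℤ.+ shift₂ 3 4 (multisum 4 8 10) m n) ℤ.+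
    (shift₂ 2 2 (multisum 3 6 10) m n ℤ.+ shift₂ 5 12 (multisum 6 12 16) m n)
    ≡⟨ rearrange (multisum 1 2 4 m n) (shift₂ 3 4 (multisum 4 8 10) m n)
         (shift₂ 2 2 (multisum 3 6 10) m n) (shift₂ 5 12 (multisum 6 12 16) m n) ⟩
  multisum 1 2 4 m n ℤ.+ (shift₂ 2 2 (multisum 3 6 10) m n ℤ.+
    (shift₂ 3 4 (multisum 4 8 10) m n ℤ.+ shift₂ 5 12 (multisum 6 12 16) m n))
    ≡⟨ cong (λ u → multisum 1 2 4 m n ℤ.+ (shift₂ 2 2 (multisum 3 6 10) m n ℤ.+ u)) collect ⟨
  multisum 1 2 4 m n ℤ.+
    (shift₂ 2 2 (multisum 3 6 10) m n ℤ.+ shift₂ 3 4 (multisum 4 6 10) m n)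
    ≡⟨ cong (λ u → multisum 1 2 4 m n ℤ.+ u) (cong₂ ℤ._+_
         (shift₂-cong 2 2 m n (multisum-twist 2 1 2 4))
         (shift₂-cong 3 4 m n (multisum-twist 3 1 0 1))) ⟩
  multisum 1 2 4 m n ℤ.+ (shift₂ 2 2 (twisted 2 (multisum 1 2 4)) m n ℤ.+
    shift₂ 3 4 (twisted 3 (multisum 1 0 1)) m n) ∎
  where
  open ≡-Reasoning
  expand : shift₂ 2 2 (multisum 3 6 7) m n ≡
    shift₂ 2 2 (multisum 3 6 10) m n ℤ.+ shift₂ 5 12 (multisum 6 12 16) m n
  expand = trans (shift₂-cong 2 2 m n (multisum-k 3 6 7))
    (trans (shift₂-+ 2 2 (multisum 3 6 10) (shift₂ 3 10 (multisum 6 12 16)) m n)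
      (cong (λ u → shift₂ 2 2 (multisum 3 6 10) m n ℤ.+ u)
        (shift₂-shift₂ 2 2 3 10 (multisum 6 12 16) m n)))
  collect : shift₂ 3 4 (multisum 4 6 10) m n ≡
    shift₂ 3 4 (multisum 4 8 10) m n ℤ.+ shift₂ 5 12 (multisum 6 12 16) m n
  collect = trans (shift₂-cong 3 4 m n (multisum-j 4 6 10))
    (trans (shift₂-+ 3 4 (multisum 4 8 10) (shift₂ 2 8 (multisum 6 12 16)) m n)
      (cong (λ u → shift₂ 3 4 (multisum 4 8 10) m n ℤ.+ u)
        (shift₂-shift₂ 3 4 2 8 (multisum 6 12 16) m n)))
  rearrange : ∀ s t u v → (s ℤ.+ t) ℤ.+ (u ℤ.+ v) ≡ s ℤ.+ (u ℤ.+ (t ℤ.+ v))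
  rearrange = ℤ-Solver.solve-∀

multisum-0 : ∀ a b c → multisum a b c 0 ≗ one
multisum-0 a b c n = trans (cong (λ u → u ℤ.+ 0ℤ ℤ.+ 0ℤ ℤ.+ 0ℤ) first) (zeros (one n))
  where
  first : term a b c 0 0 0 0 n ≡ one n
  first rewrite ℕ.*-zeroʳ a | ℕ.*-zeroʳ b | ℕ.*-zeroʳ c = weight-0 n
  zeros : ∀ u → u ℤ.+ 0ℤ ℤ.+ 0ℤ ℤ.+ 0ℤ ≡ u
  zeros = ℤ-Solver.solve-∀

-- Enumerations

-- Cardinality witnessed by an explicit duplicate-free list, which later becomes the support in
-- `HasSum`. The value is an integer so that it can be a coefficient of a series.
Counts : {A : Set} → (A → Set) → ℤ → Set
Counts {A} Q v = ∃ λ (xs : List A) →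
  Unique xs × All Q xs × (∀ {x} → Q x → x ∈ xs) × + length xs ≡ v

module _ {A : Set} {Q : A → Set} where

  counts-∅ : (∀ {x} → ¬ Q x) → Counts Q 0ℤ
  counts-∅ ¬Q = [] , [] , [] , (λ q → contradiction q ¬Q) , refl

  counts-singleton : ∀ x → Q x → (∀ {y} → Q y → y ≡ x) → Counts Q 1ℤ
  counts-singleton x q only = x ∷ [] , [] ∷ [] , q ∷ [] , (λ r → here (only r)) , refl

  counts-⇔ : ∀ {R : A → Set} {v} → (∀ {x} → Q x → R x) → (∀ {x} → R x → Q x) →
    Counts Q v → Counts R v
  counts-⇔ f g (xs , unique , sound , complete , v≡) =
    xs , unique , All.map f sound , complete ∘ g , v≡

  counts-⊎ : ∀ {R : A → Set} {v w} → (∀ {x} → Q x → ¬ R x) → Counts Q v → Counts R w →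
    Counts (λ x → Q x ⊎ R x) (v ℤ.+ w)
  counts-⊎ disjoint
    (xs , unique , sound , complete , refl) (ys , unique′ , sound′ , complete′ , refl) =
    xs ++ ys ,
    Unique.++⁺ unique unique′ (λ (x∈xs , x∈ys) →
      disjoint (All.lookup sound x∈xs) (All.lookup sound′ x∈ys)) ,
    All.++⁺ (All.map inj₁ sound) (All.map inj₂ sound′) ,
    (λ { (inj₁ q) → ∈-++⁺ˡ (complete q) ; (inj₂ r) → ∈-++⁺ʳ xs (complete′ r) }) ,
    cong +_ (List.length-++ xs)

counts-image : ∀ {A B : Set} {Q : A → Set} {v} (f : A → B) → (∀ {x y} → f x ≡ f y → x ≡ y) →
  Counts Q v → Counts (λ y → ∃ λ x → Q x × y ≡ f x) v
counts-image f injective (xs , unique , sound , complete , v≡) =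
  map f xs , Unique.map⁺ injective unique , All.map⁺ (All.map (λ q → _ , q , refl) sound) ,
  (λ { (x , q , refl) → ∈-map⁺ f (complete q) }) ,
  trans (cong +_ (List.length-map f xs)) v≡

-- Enumerations by length and sum

OfLengthAndSum : (List ℕ → Set) → ℕ → ℕ → List ℕ → Set
OfLengthAndSum P m n π = P π × length π ≡ m × sum π ≡ n

counts-[] : ∀ {P} n → P [] → Counts (OfLengthAndSum P 0 n) (one n)
counts-[] {P} zero    P[] = counts-singleton [] (P[] , refl , refl) λ { {[]} _ → refl }
counts-[] {P} (suc n) P[] = counts-∅ λ { {[]} (_ , _ , ()) }

-- The inverse of removing the initial parts `μ` and lowering all remaining parts by `t`.
extend : List ℕ → ℕ → List ℕ → List ℕ
extend μ t π = μ ++ map (t ℕ.+_) π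

extend-injective : ∀ μ t {π ρ} → extend μ t π ≡ extend μ t ρ → π ≡ ρ
extend-injective μ t = List.map-injective (ℕ.+-cancelˡ-≡ t _ _) ∘ List.++-cancelˡ μ _ _

length-extend : ∀ μ t π → length (extend μ t π) ≡ length μ ℕ.+ length π
length-extend μ t π = trans (List.length-++ μ) (cong (length μ ℕ.+_) (List.length-map _ π))

sum-map-+ : ∀ t π → sum (map (t ℕ.+_) π) ≡ t ℕ.* length π ℕ.+ sum π
sum-map-+ t []      = sym (trans (ℕ.+-identityʳ _) (ℕ.*-zeroʳ t))
sum-map-+ t (x ∷ π) = trans (cong (t ℕ.+ x ℕ.+_) (sum-map-+ t π)) (rearrange t x (length π) (sum π))
  where
  rearrange : ∀ t x l s → t ℕ.+ x ℕ.+ (t ℕ.* l ℕ.+ s) ≡ t ℕ.* suc l ℕ.+ (x ℕ.+ s)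
  rearrange = ℕ-Solver.solve-∀

sum-extend : ∀ μ t π → sum (extend μ t π) ≡ sum μ ℕ.+ (t ℕ.* length π ℕ.+ sum π)
sum-extend μ t π = trans (sum-++ μ _) (cong (sum μ ℕ.+_) (sum-map-+ t π))

Extended : List ℕ → ℕ → (List ℕ → Set) → List ℕ → Set
Extended μ t P ρ = ∃ λ π → P π × ρ ≡ extend μ t π

shift-view : ∀ e f n →
  (∃ λ n′ → e ℕ.+ n′ ≡ n × shift e f n ≡ f n′) ⊎
  ((∀ n′ → e ℕ.+ n′ ≢ n) × shift e f n ≡ 0ℤ)
shift-view zero    f n    = inj₁ (n , refl , refl)
shift-view (suc e) f zero = inj₂ ((λ _ ()) , refl)
shift-view (suc e) f (suc n) with shift-view e f n
... | inj₁ (n′ , eq , value) = inj₁ (n′ , cong suc eq , value)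
... | inj₂ (e+≢n , value)    = inj₂ ((λ n′ → e+≢n n′ ∘ ℕ.suc-injective) , value)

-- If F(x) is the generating function of `P`, then x^ℓ(μ) q^|μ| F(x q^t) is that of the extended
-- lists. Counts of `P` are requested only at the coefficient that can contribute, so that the lemma
-- fits inside an induction. If one of the three shifts overshoots, the prefix or the raising by `t`
-- already exceeds the prescribed length or sum, and there is nothing to count.
counts-extended : ∀ μ t P F m n →
  (∀ m′ n′ → length μ ℕ.+ m′ ≡ m → sum μ ℕ.+ (t ℕ.* m′ ℕ.+ n′) ≡ n →
    Counts (OfLengthAndSum P m′ n′) (F m′ n′)) →
  Counts (OfLengthAndSum (Extended μ t P) m n) (shift₂ (length μ) (sum μ) (twisted t F) m n)
counts-extended μ t P F m n counts
  with shift-view (length μ) (λ m′ → shift (sum μ) (twisted t F m′) n) m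
... | inj₂ (μ+≢m , value) = subst (Counts _) (sym value)
  (counts-∅ λ { ((π , _ , refl) , length≡ , _) →
    μ+≢m (length π) (trans (sym (length-extend μ t π)) length≡) })
... | inj₁ (m′ , refl , value) with shift-view (sum μ) (twisted t F m′) n
...   | inj₂ (μ+≢n , value′) = subst (Counts _) (sym (trans value value′))
  (counts-∅ λ { ((π , _ , refl) , _ , sum≡) →
    μ+≢n (t ℕ.* length π ℕ.+ sum π) (trans (sym (sum-extend μ t π)) sum≡) })
...   | inj₁ (n′ , refl , value′) with shift-view (t ℕ.* m′) (F m′) n′
...     | inj₂ (t+≢n′ , value″) = subst (Counts _) (sym (trans value (trans value′ value″)))
  (counts-∅ λ { ((π , _ , refl) , length≡ , sum≡) → t+≢n′ (sum π)
    (trans (cong (λ l → t ℕ.* l ℕ.+ sum π) (sym (length-cancel π length≡)))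
      (sum-cancel π sum≡)) })
  where
  length-cancel : ∀ π → length (extend μ t π) ≡ length μ ℕ.+ m′ → length π ≡ m′
  length-cancel π eq = ℕ.+-cancelˡ-≡ (length μ) _ _ (trans (sym (length-extend μ t π)) eq)
  sum-cancel : ∀ π → sum (extend μ t π) ≡ sum μ ℕ.+ n′ → t ℕ.* length π ℕ.+ sum π ≡ n′
  sum-cancel π eq = ℕ.+-cancelˡ-≡ (sum μ) _ _ (trans (sym (sum-extend μ t π)) eq)
...     | inj₁ (n″ , refl , value″) = subst (Counts _) (sym (trans value (trans value′ value″)))
  (counts-⇔ to from
    (counts-image (extend μ t) (extend-injective μ t) (counts m′ n″ refl refl)))
  where
  to : ∀ {ρ} → (∃ λ π → OfLengthAndSum P m′ n″ π × ρ ≡ extend μ t π) →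
    OfLengthAndSum (Extended μ t P) (length μ ℕ.+ m′) (sum μ ℕ.+ (t ℕ.* m′ ℕ.+ n″)) ρ
  to (π , (p , refl , refl) , refl) = (π , p , refl) , length-extend μ t π , sum-extend μ t π
  from : ∀ {ρ} →
    OfLengthAndSum (Extended μ t P) (length μ ℕ.+ m′) (sum μ ℕ.+ (t ℕ.* m′ ℕ.+ n″)) ρ →
    ∃ λ π → OfLengthAndSum P m′ n″ π × ρ ≡ extend μ t π
  from ((π , p , refl) , length≡ , sum≡)
    with refl ← ℕ.+-cancelˡ-≡ (length μ) _ _ (trans (sym (length-extend μ t π)) length≡) =
    π , (p , refl , ℕ.+-cancelˡ-≡ (t ℕ.* length π) _ _
      (ℕ.+-cancelˡ-≡ (sum μ) _ _ (trans (sym (sum-extend μ t π)) sum≡))) , refl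

-- Condition(1) as a local condition on consecutive parts

-- For x ≤ y ≤ z this says: if z ≤ 1 + x then x + y + z ≡ 1 (mod 3).
Triple : ℕ → ℕ → ℕ → Set
Triple x y z = 2 ℕ.+ x ℕ.≤ z ⊎ (y ≡ x × z ≡ 1 ℕ.+ x)

-- All constraints whose smallest index is that of `x`; they reach at most three parts ahead.
Precedes : ℕ → List ℕ → Set
Precedes x []              = ⊤
Precedes x (y ∷ [])        = x ℕ.≤ y
Precedes x (y ∷ z ∷ [])    = x ℕ.≤ y × Triple x y z
Precedes x (y ∷ z ∷ w ∷ _) = x ℕ.≤ y × Triple x y z × 3 ℕ.+ x ℕ.≤ w

Chain : List ℕ → Set
Chain []      = ⊤
Chain (x ∷ π) = Precedes x π × Chain π

precedes-≤ : ∀ {x y} π → Precedes x (y ∷ π) → x ℕ.≤ y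
precedes-≤ []          x≤y       = x≤y
precedes-≤ (_ ∷ [])    (x≤y , _) = x≤y
precedes-≤ (_ ∷ _ ∷ _) (x≤y , _) = x≤y

precedes-triple : ∀ {x y z} π → Precedes x (y ∷ z ∷ π) → Triple x y z
precedes-triple []      (_ , triple)     = triple
precedes-triple (_ ∷ _) (_ , triple , _) = triple

chain-sorted : ∀ π → Chain π → Sorted π
chain-sorted []          _           = []
chain-sorted (_ ∷ [])    _           = [-]
chain-sorted (_ ∷ y ∷ π) (pre , chain) = precedes-≤ π pre ∷ chain-sorted (y ∷ π) chain

chain-≤ : ∀ {x b} π → b ℕ.≤ x → Chain (x ∷ π) → All (b ℕ.≤_) (x ∷ π)
chain-≤ []      b≤x _             = b≤x ∷ []
chain-≤ (y ∷ π) b≤x (pre , chain) = b≤x ∷ chain-≤ π (ℕ.≤-trans b≤x (precedes-≤ π pre)) chain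

condition-tail : ∀ {c x π} → Condition c (x ∷ π) → Condition c π
condition-tail condition = record
  { gap = λ s t eq → gap (suc s) (suc t) (cong suc eq)
  ; congruence = λ s t u eq₁ eq₂ → congruence (suc s) (suc t) (suc u) (cong suc eq₁) (cong suc eq₂)
  }
  where open Condition condition

-- Three parts with difference at most 1 are (x,x,x), (x,x,x+1) or (x,x+1,x+1), with sums 0, 1, 2
-- modulo 3, so only the middle shape survives. Matching `x` as a successor makes the subtraction of
-- 1 compute to a natural number; in the two excluded cases it leaves remainder 2 or 1.
triple⁺ : ∀ {x y z} → 1 ℕ.≤ x → x ℕ.≤ y → y ℕ.≤ z →
  (z ℕ.≤ 1 ℕ.+ x → + 3 ∣ (+ (x ℕ.+ y ℕ.+ z) ℤ.- + 1)) → Triple x y z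
triple⁺ {suc x} {y} {z} _ x≤y y≤z congruent with 2 ℕ.+ suc x ℕ.≤? z
... | yes 2+x≤z = inj₁ 2+x≤z
... | no  2+x≰z with y ℕ.≟ suc x | z ℕ.≟ suc x
...   | yes refl | yes refl = contradiction
  (ℕ.∣⇒≤ (ℕ.∣m+n∣m⇒∣n (subst (3 ℕ.∣_) (mod₂ x) (congruent (ℕ.n≤1+n _))) (ℕ.m∣m*n x)))
  λ { (s≤s (s≤s ())) }
  where
  mod₂ : ∀ x → x ℕ.+ suc x ℕ.+ suc x ≡ 3 ℕ.* x ℕ.+ 2
  mod₂ = ℕ-Solver.solve-∀
...   | yes refl | no  z≢x  =
  inj₂ (refl , ℕ.≤-antisym (ℕ.≤-pred (ℕ.≰⇒> 2+x≰z)) (ℕ.≤∧≢⇒< y≤z (z≢x ∘ sym)))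
...   | no  y≢x  | _ = contradiction
  (ℕ.∣⇒≤ (ℕ.∣m+n∣m⇒∣n (subst (3 ℕ.∣_) 1mod3 (congruent z≤2+x)) (ℕ.m∣m*n (suc x))))
  λ { (s≤s ()) }
  where
  z≤2+x : z ℕ.≤ 2 ℕ.+ x
  z≤2+x = ℕ.≤-pred (ℕ.≰⇒> 2+x≰z)
  2+x≤y : 2 ℕ.+ x ℕ.≤ y
  2+x≤y = ℕ.≤∧≢⇒< x≤y (y≢x ∘ sym)
  mod₁ : ∀ x → x ℕ.+ suc (suc x) ℕ.+ suc (suc x) ≡ 3 ℕ.* suc x ℕ.+ 1
  mod₁ = ℕ-Solver.solve-∀
  1mod3 : x ℕ.+ y ℕ.+ z ≡ 3 ℕ.* suc x ℕ.+ 1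
  1mod3 = trans (cong₂ (λ y z → x ℕ.+ y ℕ.+ z)
    (ℕ.≤-antisym (ℕ.≤-trans y≤z z≤2+x) 2+x≤y)
    (ℕ.≤-antisym z≤2+x (ℕ.≤-trans 2+x≤y y≤z))) (mod₁ x)

triple⁻ : ∀ {x y z} → Triple x y z → z ℕ.≤ 1 ℕ.+ x → + 3 ∣ (+ (x ℕ.+ y ℕ.+ z) ℤ.- + 1)
triple⁻ (inj₁ 2+x≤z) z≤1+x = contradiction (ℕ.≤-trans 2+x≤z z≤1+x) (ℕ.<-irrefl refl)
-- The rewrite brings the successor of the last part to the front, where it cancels the subtracted
-- 1.
triple⁻ {x} (inj₂ (refl , refl)) _ rewrite ℕ.+-suc (x ℕ.+ x) x =
  subst (3 ℕ.∣_) (triple x) (ℕ.m∣m*n x)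
  where
  triple : ∀ x → 3 ℕ.* x ≡ x ℕ.+ x ℕ.+ x
  triple = ℕ-Solver.solve-∀

chain⁺ : ∀ π → Sorted π → All (1 ℕ.≤_) π → Condition (+ 1) π → Chain π
chain⁺ []      _      _              _         = tt
chain⁺ (x ∷ π) sorted (1≤x ∷ 1≤π) condition =
  precedes π sorted condition , chain⁺ π (Linked.tail sorted) 1≤π (condition-tail condition)
  where
  triple : ∀ {y z π} → Sorted (x ∷ y ∷ z ∷ π) → Condition (+ 1) (x ∷ y ∷ z ∷ π) → Triple x y z
  triple (x≤y ∷ y≤z ∷ _) condition = triple⁺ 1≤x x≤y y≤z
    (Condition.congruence condition zero (suc zero) (suc (suc zero)) refl refl)
  precedes : ∀ π → Sorted (x ∷ π) → Condition (+ 1) (x ∷ π) → Precedes x π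
  precedes []              _      _         = tt
  precedes (y ∷ [])        sorted _         = Linked.head sorted
  precedes (y ∷ z ∷ [])    sorted condition = Linked.head sorted , triple sorted condition
  precedes (y ∷ z ∷ w ∷ _) sorted condition = Linked.head sorted , triple sorted condition ,
    Condition.gap condition zero (suc (suc (suc zero))) refl

chain⁻ : ∀ {π} → Chain π → Condition (+ 1) π
chain⁻ {π} chain = record { gap = gap π chain ; congruence = congruence π chain }
  where
  gap : ∀ π → Chain π → ∀ (s t : Fin (length π)) → toℕ t ≡ 3 ℕ.+ toℕ s →
    3 ℕ.+ lookup π s ℕ.≤ lookup π t
  gap (x ∷ π) (_ , chain) (suc s) (suc t) eq = gap π chain s t (ℕ.suc-injective eq)
  gap (x ∷ y ∷ z ∷ w ∷ π) ((_ , _ , 3+x≤w) , _) zero (suc (suc (suc zero))) _ = 3+x≤w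
  gap (x ∷ []) _ zero zero ()
  gap (x ∷ y ∷ []) _ zero zero ()
  gap (x ∷ y ∷ []) _ zero (suc zero) ()
  gap (x ∷ y ∷ z ∷ []) _ zero zero ()
  gap (x ∷ y ∷ z ∷ []) _ zero (suc zero) ()
  gap (x ∷ y ∷ z ∷ []) _ zero (suc (suc zero)) ()
  gap (x ∷ y ∷ z ∷ w ∷ π) _ zero (suc (suc (suc (suc t)))) ()
  congruence : ∀ π → Chain π → ∀ (s t u : Fin (length π)) →
    toℕ t ≡ 1 ℕ.+ toℕ s → toℕ u ≡ 2 ℕ.+ toℕ s → lookup π u ℕ.≤ 1 ℕ.+ lookup π s →
    + 3 ∣ (+ (lookup π s ℕ.+ lookup π t ℕ.+ lookup π u) ℤ.- + 1)
  congruence (x ∷ π) (_ , chain) (suc s) (suc t) (suc u) eq₁ eq₂ =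
    congruence π chain s t u (ℕ.suc-injective eq₁) (ℕ.suc-injective eq₂)
  congruence (x ∷ y ∷ z ∷ π) (pre , _) zero (suc zero) (suc (suc zero)) _ _ =
    triple⁻ (precedes-triple π pre)
  congruence (x ∷ []) _ zero zero _ ()
  congruence (x ∷ y ∷ []) _ zero _ zero _ ()
  congruence (x ∷ y ∷ []) _ zero _ (suc zero) _ ()
  congruence (x ∷ y ∷ z ∷ π) _ zero (suc (suc t)) _ ()
  congruence (x ∷ y ∷ z ∷ π) _ zero (suc zero) (suc (suc (suc u))) _ ()

-- Invariance under translation of all parts

swap : ∀ k t x → k ℕ.+ (t ℕ.+ x) ≡ t ℕ.+ (k ℕ.+ x)
swap = ℕ-Solver.solve-∀

gap-map⁺ : ∀ k t {x z} → k ℕ.+ x ℕ.≤ z → k ℕ.+ (t ℕ.+ x) ℕ.≤ t ℕ.+ z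
gap-map⁺ k t {x} {z} k+x≤z = subst (ℕ._≤ t ℕ.+ z) (sym (swap k t x)) (ℕ.+-monoʳ-≤ t k+x≤z)

gap-map⁻ : ∀ k t {x z} → k ℕ.+ (t ℕ.+ x) ℕ.≤ t ℕ.+ z → k ℕ.+ x ℕ.≤ z
gap-map⁻ k t {x} {z} gap = ℕ.+-cancelˡ-≤ t _ _ (subst (ℕ._≤ t ℕ.+ z) (swap k t x) gap)

-- Adding `t` to three parts changes their sum by 3t, so the congruence is kept; `Triple` mentions
-- only differences, which makes this visible.
triple-map⁺ : ∀ t {x y z} → Triple x y z → Triple (t ℕ.+ x) (t ℕ.+ y) (t ℕ.+ z)
triple-map⁺ t     (inj₁ 2+x≤z)         = inj₁ (gap-map⁺ 2 t 2+x≤z)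
triple-map⁺ t {x} (inj₂ (refl , refl)) = inj₂ (refl , sym (swap 1 t x))

triple-map⁻ : ∀ t {x y z} → Triple (t ℕ.+ x) (t ℕ.+ y) (t ℕ.+ z) → Triple x y z
triple-map⁻ t     (inj₁ 2+x≤z)          = inj₁ (gap-map⁻ 2 t 2+x≤z)
triple-map⁻ t {x} (inj₂ (y≡x , z≡1+x)) =
  inj₂ (ℕ.+-cancelˡ-≡ t _ _ y≡x , ℕ.+-cancelˡ-≡ t _ _ (trans z≡1+x (swap 1 t x)))

chain-map⁺ : ∀ t π → Chain π → Chain (map (t ℕ.+_) π)
chain-map⁺ t []      _             = tt
chain-map⁺ t (x ∷ π) (pre , chain) = precedes π pre , chain-map⁺ t π chain
  where
  precedes : ∀ π → Precedes x π → Precedes (t ℕ.+ x) (map (t ℕ.+_) π)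
  precedes []              _              = tt
  precedes (y ∷ [])        x≤y            = ℕ.+-monoʳ-≤ t x≤y
  precedes (y ∷ z ∷ [])    (x≤y , triple) = ℕ.+-monoʳ-≤ t x≤y , triple-map⁺ t triple
  precedes (y ∷ z ∷ w ∷ _) (x≤y , triple , 3+x≤w) =
    ℕ.+-monoʳ-≤ t x≤y , triple-map⁺ t triple ,
    gap-map⁺ 3 t 3+x≤w

chain-map⁻ : ∀ t π → Chain (map (t ℕ.+_) π) → Chain π
chain-map⁻ t []      _             = tt
chain-map⁻ t (x ∷ π) (pre , chain) = precedes π pre , chain-map⁻ t π chain
  where
  precedes : ∀ π → Precedes (t ℕ.+ x) (map (t ℕ.+_) π) → Precedes x π
  precedes []              _              = tt
  precedes (y ∷ [])        x≤y            = ℕ.+-cancelˡ-≤ t _ _ x≤y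
  precedes (y ∷ z ∷ [])    (x≤y , triple) = ℕ.+-cancelˡ-≤ t _ _ x≤y , triple-map⁻ t triple
  precedes (y ∷ z ∷ w ∷ _) (x≤y , triple , 3+x≤w) =
    ℕ.+-cancelˡ-≤ t _ _ x≤y , triple-map⁻ t triple ,
    gap-map⁻ 3 t 3+x≤w

-- Decomposition of partitions according to their parts 1 and 2

𝒜 : List ℕ → Set
𝒜 π = Chain π × All (1 ℕ.≤_) π

-- For weakly increasing positive parts, the bound on the number of 1s concerns the second part
-- only.
AtMostOneOne : List ℕ → Set
AtMostOneOne []          = ⊤
AtMostOneOne (_ ∷ [])    = ⊤
AtMostOneOne (_ ∷ y ∷ _) = 2 ℕ.≤ y

𝒞 : List ℕ → Set
𝒞 π = 𝒜 π × AtMostOneOne π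

unmap : ∀ t {π} → All (1 ℕ.+ t ℕ.≤_) π → ∃ λ π′ → All (1 ℕ.≤_) π′ × π ≡ map (t ℕ.+_) π′
unmap t []          = [] , [] , refl
unmap t (t<x ∷ t<π) with o , refl ← ℕ.m≤n⇒∃[o]m+o≡n t<x | π′ , 1≤π′ , refl ← unmap t t<π =
  suc o ∷ π′ , s≤s z≤n ∷ 1≤π′ , cong (_∷ map (t ℕ.+_) π′) (sym (ℕ.+-suc t o))

subtract : ∀ t {π} → Chain π → All (1 ℕ.+ t ℕ.≤_) π →
  ∃ λ π′ → 𝒜 π′ × π ≡ map (t ℕ.+_) π′
subtract t chain t<π with π′ , 1≤π′ , refl ← unmap t t<π =
  π′ , (chain-map⁻ t π′ chain , 1≤π′) , refl

add : ∀ t {π} → All (1 ℕ.≤_) π → All (1 ℕ.+ t ℕ.≤_) (map (t ℕ.+_) π)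
add t 1≤π = All.map⁺ (All.map (λ {x} 1≤x →
  subst (ℕ._≤ t ℕ.+ x) (ℕ.+-comm t 1) (ℕ.+-monoʳ-≤ t 1≤x)) 1≤π)

add-positive : ∀ t {π} → All (1 ℕ.≤_) π → All (1 ℕ.≤_) (map (t ℕ.+_) π)
add-positive t = All.map (ℕ.≤-trans (s≤s z≤n)) ∘ add t

-- Without a part 1, lowering by 1 gives an arbitrary member of `𝒜`. With one part 1, the others are
-- at least 2, and at most one of them is 2: the triple (1,2,2) has sum 2 modulo 3. Hence the
-- lowered rest lies in `𝒞`.
𝒞-split : ∀ {π} → 𝒞 π → Extended [] 1 𝒜 π ⊎ Extended (1 ∷ []) 1 𝒞 π
𝒞-split {[]} _ = inj₁ ([] , (tt , []) , refl)
𝒞-split {zero ∷ _} ((_ , () ∷ _) , _)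
𝒞-split {suc (suc x) ∷ π} ((chain , _) , _) =
  inj₁ (subtract 1 chain (chain-≤ π (s≤s (s≤s z≤n)) chain))
𝒞-split {1 ∷ []} _ = inj₂ ([] , ((tt , []) , tt) , refl)
𝒞-split {1 ∷ y ∷ π} ((chain , _) , 2≤y)
  with π′ , 𝒜π′ , eq ← subtract 1 (proj₂ chain) (chain-≤ π 2≤y (proj₂ chain)) =
  inj₂ (π′ , (𝒜π′ , atMostOneOne π′ 𝒜π′ (subst (Precedes 1) eq (proj₁ chain))) , cong (1 ∷_) eq)
  where
  atMostOneOne : ∀ π′ → 𝒜 π′ → Precedes 1 (map suc π′) → AtMostOneOne π′
  atMostOneOne []              _ _ = tt
  atMostOneOne (_ ∷ [])        _ _ = tt
  atMostOneOne (a ∷ b ∷ π′) (_ , 1≤a ∷ _) pre with precedes-triple (map suc π′) pre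
  ... | inj₁ (s≤s 2≤b)  = 2≤b
  ... | inj₂ (refl , _) = contradiction 1≤a λ ()

𝒞-join : ∀ {π} → Extended [] 1 𝒜 π ⊎ Extended (1 ∷ []) 1 𝒞 π → 𝒞 π
𝒞-join (inj₁ (π , (chain , 1≤π) , refl)) =
  (chain-map⁺ 1 π chain , add-positive 1 1≤π) , atMostOneOne (add 1 1≤π)
  where
  atMostOneOne : ∀ {π} → All (2 ℕ.≤_) π → AtMostOneOne π
  atMostOneOne []              = tt
  atMostOneOne (_ ∷ [])        = tt
  atMostOneOne (_ ∷ 2≤y ∷ _) = 2≤y
𝒞-join (inj₂ (π , ((chain , 1≤π) , amoo) , refl)) =
  ((precedes π chain 1≤π amoo , chain-map⁺ 1 π chain) , s≤s z≤n ∷ add-positive 1 1≤π) ,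
  second 1≤π
  where
  second : ∀ {π} → All (1 ℕ.≤_) π → AtMostOneOne (1 ∷ map suc π)
  second []        = tt
  second (1≤a ∷ _) = s≤s 1≤a
  precedes : ∀ π → Chain π → All (1 ℕ.≤_) π → AtMostOneOne π → Precedes 1 (map suc π)
  precedes []           _ _ _ = tt
  precedes (a ∷ [])     _ _ _ = s≤s z≤n
  precedes (a ∷ b ∷ []) _ _ 2≤b = s≤s z≤n , inj₁ (s≤s 2≤b)
  precedes (a ∷ b ∷ c ∷ π) ((pre , pre′ , _)) (1≤a ∷ _) 2≤b =
    s≤s z≤n , inj₁ (s≤s 2≤b) , s≤s 3≤c
    where
    -- The gap condition from the leading 1 to the fourth part `suc c`. Either c ≥ a + 2, or a = b
    -- and c = b + 1 with b ≥ 2.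
    3≤c : 3 ℕ.≤ c
    3≤c with precedes-triple π pre
    ... | inj₁ 2+a≤c         = ℕ.≤-trans (s≤s (s≤s 1≤a)) 2+a≤c
    ... | inj₂ (refl , refl) = s≤s 2≤b

𝒞-disjoint : ∀ {π} → Extended [] 1 𝒜 π → ¬ Extended (1 ∷ []) 1 𝒞 π
𝒞-disjoint (suc _ ∷ _ , _ , refl) (_ , _ , ())
𝒞-disjoint (zero ∷ _ , (_ , () ∷ _) , _) _

-- After 1+1 the third part is 2 or at least 3, as 1+1+1 is excluded, and a fourth part is at least
-- 4. If the third part is at least 3, lowering by 2 makes the second remaining part at least 2,
-- which is the bound of `𝒞`; if it is 2, lowering by 3 gives an arbitrary member of `𝒜`.
𝒜-split : ∀ {π} → 𝒜 π →
  𝒞 π ⊎ (Extended (1 ∷ 1 ∷ []) 2 𝒞 π ⊎ Extended (1 ∷ 1 ∷ 2 ∷ []) 3 𝒜 π)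
𝒜-split {[]}                        𝒜π = inj₁ (𝒜π , tt)
𝒜-split {_ ∷ []}                    𝒜π = inj₁ (𝒜π , tt)
𝒜-split {_ ∷ suc (suc y) ∷ _}       𝒜π = inj₁ (𝒜π , s≤s (s≤s z≤n))
𝒜-split {_ ∷ zero ∷ _}              (_ , _ ∷ () ∷ _)
𝒜-split {zero ∷ 1 ∷ _}              (_ , () ∷ _)
𝒜-split {suc (suc x) ∷ 1 ∷ π}       ((pre , _) , _) =
  contradiction (precedes-≤ π pre) λ { (s≤s ()) }
𝒜-split {1 ∷ 1 ∷ []}                _  = inj₂ (inj₁ ([] , ((tt , []) , tt) , refl))
𝒜-split {1 ∷ 1 ∷ z ∷ π} ((pre , _ , chain) , _) with precedes-triple π pre
... | inj₁ 3≤z with π′ , 𝒜π′ , eq ← subtract 2 chain (chain-≤ π 3≤z chain) =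
  inj₂ (inj₁ (π′ , (𝒜π′ , atMostOneOne π′ (subst (λ ρ → Precedes 1 (1 ∷ ρ)) eq pre)) ,
    cong (λ ρ → 1 ∷ 1 ∷ ρ) eq))
  where
  atMostOneOne : ∀ π′ → Precedes 1 (1 ∷ map (2 ℕ.+_) π′) → AtMostOneOne π′
  atMostOneOne []          _                           = tt
  atMostOneOne (_ ∷ [])    _                           = tt
  atMostOneOne (_ ∷ _ ∷ _) (_ , _ , s≤s (s≤s 2≤b)) = 2≤b
... | inj₂ (_ , refl) = inj₂ (inj₂ (rest π pre chain))
  where
  rest : ∀ π → Precedes 1 (1 ∷ 2 ∷ π) → Chain (2 ∷ π) →
    Extended (1 ∷ 1 ∷ 2 ∷ []) 3 𝒜 (1 ∷ 1 ∷ 2 ∷ π)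
  rest []      _             _           = [] , (tt , []) , refl
  rest (w ∷ π) (_ , _ , 4≤w) (_ , chain)
    with π′ , 𝒜π′ , eq ← subtract 3 chain (chain-≤ π 4≤w chain) =
    π′ , 𝒜π′ , cong (λ ρ → 1 ∷ 1 ∷ 2 ∷ ρ) eq

-- Only constraints starting in the prefix are new, one local function for each of its parts; those
-- of the remaining parts are translated.
𝒜-join : ∀ {π} → 𝒞 π ⊎ (Extended (1 ∷ 1 ∷ []) 2 𝒞 π ⊎ Extended (1 ∷ 1 ∷ 2 ∷ []) 3 𝒜 π) → 𝒜 π
𝒜-join (inj₁ (𝒜π , _)) = 𝒜π
𝒜-join (inj₂ (inj₁ (π , ((chain , 1≤π) , amoo) , refl))) =
  (first π 1≤π amoo , second π chain 1≤π amoo , chain-map⁺ 2 π chain) ,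
  s≤s z≤n ∷ s≤s z≤n ∷ add-positive 2 1≤π
  where
  first : ∀ π → All (1 ℕ.≤_) π → AtMostOneOne π → Precedes 1 (1 ∷ map (2 ℕ.+_) π)
  first []          _         _   = s≤s z≤n
  first (a ∷ [])    (1≤a ∷ _) _   = s≤s z≤n , inj₁ (s≤s (s≤s 1≤a))
  first (a ∷ b ∷ _) (1≤a ∷ _) 2≤b = s≤s z≤n , inj₁ (s≤s (s≤s 1≤a)) , s≤s (s≤s 2≤b)
  second : ∀ π → Chain π → All (1 ℕ.≤_) π → AtMostOneOne π → Precedes 1 (map (2 ℕ.+_) π)
  second []              _ _ _   = tt
  second (a ∷ [])        _ _ _   = s≤s z≤n
  second (a ∷ b ∷ [])    _ _ 2≤b = s≤s z≤n , inj₁ (s≤s (s≤s (ℕ.≤-trans (s≤s z≤n) 2≤b)))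
  second (a ∷ b ∷ c ∷ π) (_ , pre , _) _ 2≤b =
    s≤s z≤n , inj₁ (s≤s (s≤s (ℕ.≤-trans (s≤s z≤n) 2≤b))) ,
    s≤s (s≤s (ℕ.≤-trans 2≤b (precedes-≤ π pre)))
𝒜-join (inj₂ (inj₂ (π , (chain , 1≤π) , refl))) =
  (first π 1≤π , second π 1≤π , third π chain 1≤π , chain-map⁺ 3 π chain) ,
  s≤s z≤n ∷ s≤s z≤n ∷ s≤s z≤n ∷ add-positive 3 1≤π
  where
  first : ∀ π → All (1 ℕ.≤_) π → Precedes 1 (1 ∷ 2 ∷ map (3 ℕ.+_) π)
  first []      _         = s≤s z≤n , inj₂ (refl , refl)
  first (a ∷ _) (1≤a ∷ _) = s≤s z≤n , inj₂ (refl , refl) , s≤s (s≤s (s≤s 1≤a))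
  second : ∀ π → All (1 ℕ.≤_) π → Precedes 1 (2 ∷ map (3 ℕ.+_) π)
  second []          _               = s≤s z≤n
  second (a ∷ [])    _               = s≤s z≤n , inj₁ (s≤s (s≤s (s≤s z≤n)))
  second (a ∷ b ∷ _) (_ ∷ 1≤b ∷ _) =
    s≤s z≤n , inj₁ (s≤s (s≤s (s≤s z≤n))) , s≤s (s≤s (s≤s 1≤b))
  third : ∀ π → Chain π → All (1 ℕ.≤_) π → Precedes 2 (map (3 ℕ.+_) π)
  third []           _ _               = tt
  third (a ∷ [])     _ _               = s≤s (s≤s z≤n)
  third (a ∷ b ∷ []) _ (_ ∷ 1≤b ∷ _) = s≤s (s≤s z≤n) , inj₁ (s≤s (s≤s (s≤s 1≤b)))
  third (a ∷ b ∷ c ∷ π) (pre , _) (1≤a ∷ 1≤b ∷ _) =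
    s≤s (s≤s z≤n) , inj₁ (s≤s (s≤s (s≤s 1≤b))) , s≤s (s≤s (s≤s 2≤c))
    where
    -- The gap condition from the prefix part 2 to `3 + c`; it holds because a, b, c cannot all be
    -- 1.
    2≤c : 2 ℕ.≤ c
    2≤c with precedes-triple π pre
    ... | inj₁ 2+a≤c      = ℕ.≤-trans (s≤s (s≤s z≤n)) 2+a≤c
    ... | inj₂ (_ , refl) = s≤s 1≤a

𝒜-disjoint₁ : ∀ {π} → 𝒞 π → ¬ (Extended (1 ∷ 1 ∷ []) 2 𝒞 π ⊎ Extended (1 ∷ 1 ∷ 2 ∷ []) 3 𝒜 π)
𝒜-disjoint₁ (_ , amoo) (inj₁ (_ , _ , refl)) = contradiction amoo λ { (s≤s ()) }
𝒜-disjoint₁ (_ , amoo) (inj₂ (_ , _ , refl)) = contradiction amoo λ { (s≤s ()) }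

𝒜-disjoint₂ : ∀ {π} → Extended (1 ∷ 1 ∷ []) 2 𝒞 π → ¬ Extended (1 ∷ 1 ∷ 2 ∷ []) 3 𝒜 π
𝒜-disjoint₂ (suc _ ∷ _ , _ , refl) (_ , _ , ())
𝒜-disjoint₂ (zero ∷ _ , ((_ , () ∷ _) , _) , _) _

-- Counting by the q-difference equations

counts-by-⊎ : ∀ {P Q R m n v w} → (∀ {π} → P π → Q π ⊎ R π) → (∀ {π} → Q π ⊎ R π → P π) →
  (∀ {π} → Q π → ¬ R π) →
  Counts (OfLengthAndSum Q m n) v → Counts (OfLengthAndSum R m n) w →
  Counts (OfLengthAndSum P m n) (v ℤ.+ w)
counts-by-⊎ {P} {Q} {R} {m} {n} split join disjoint countsQ countsR = counts-⇔ to from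
  (counts-⊎ (λ (q , _) (r , _) → disjoint q r) countsQ countsR)
  where
  to : ∀ {π} → OfLengthAndSum Q m n π ⊎ OfLengthAndSum R m n π → OfLengthAndSum P m n π
  to (inj₁ (q , eqs)) = join (inj₁ q) , eqs
  to (inj₂ (r , eqs)) = join (inj₂ r) , eqs
  from : ∀ {π} → OfLengthAndSum P m n π → OfLengthAndSum Q m n π ⊎ OfLengthAndSum R m n π
  from (p , eqs) with split p
  ... | inj₁ q = inj₁ (q , eqs)
  ... | inj₂ r = inj₂ (r , eqs)

-- Both counts are proved together, by induction on a bound for m + n. The count for `𝒞` needs `𝒜`
-- with the same length but smaller sum, or shorter lists; the count for `𝒜` uses the one for `𝒞` at
-- the same (m, n), already obtained, and shorter lists.
counts-multisum : ∀ b m n → m ℕ.+ n ℕ.≤ b →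
  Counts (OfLengthAndSum 𝒜 m n) (multisum 1 0 1 m n) ×
  Counts (OfLengthAndSum 𝒞 m n) (multisum 1 2 4 m n)
counts-multisum b zero n _ =
  subst (Counts _) (sym (multisum-0 1 0 1 n)) (counts-[] n (tt , [])) ,
  subst (Counts _) (sym (multisum-0 1 2 4 n)) (counts-[] n ((tt , []) , tt))
counts-multisum (suc b) m@(suc m-1) n (s≤s m-1+n≤b) = counts𝒜 , counts𝒞
  where
  smaller : ∀ {m′ n′} s → m′ ℕ.≤ m-1 → s ℕ.+ n′ ≡ n → m′ ℕ.+ n′ ℕ.≤ b
  smaller s m′≤m-1 refl = ℕ.≤-trans (ℕ.+-mono-≤ m′≤m-1 (ℕ.m≤n+m _ s)) m-1+n≤b
  -- Here `suc d` is the length of the removed prefix: m drops by at least one and n does not grow.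
  later : ∀ {m′ n′} d s t → suc d ℕ.+ m′ ≡ m → s ℕ.+ (t ℕ.* m′ ℕ.+ n′) ≡ n → m′ ℕ.+ n′ ℕ.≤ b
  later {m′} d s t refl eq =
    smaller (s ℕ.+ t ℕ.* m′) (ℕ.m≤n+m m′ d) (trans (ℕ.+-assoc s _ _) eq)
  counts𝒞 : Counts (OfLengthAndSum 𝒞 m n) (multisum 1 2 4 m n)
  counts𝒞 = subst (Counts _) (sym (multisum-124 m n))
    (counts-by-⊎ 𝒞-split 𝒞-join 𝒞-disjoint
      (counts-extended [] 1 𝒜 (multisum 1 0 1) m n same)
      (counts-extended (1 ∷ []) 1 𝒞 (multisum 1 2 4) m n
        λ m′ n′ eq₁ eq₂ → proj₂ (counts-multisum b m′ n′ (later 0 1 1 eq₁ eq₂))))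
    where
    same : ∀ m′ n′ → m′ ≡ m → 1 ℕ.* m′ ℕ.+ n′ ≡ n →
      Counts (OfLengthAndSum 𝒜 m′ n′) (multisum 1 0 1 m′ n′)
    -- Nothing is removed, so the decrease comes from the sum: n = m + n′ with m positive.
    same _ n′ refl refl = proj₁ (counts-multisum b m n′
      (ℕ.≤-trans (subst (m ℕ.+ n′ ℕ.≤_) (rearrange m-1 n′) (ℕ.m≤n+m (m ℕ.+ n′) m-1)) m-1+n≤b))
      where
      rearrange : ∀ k n′ → k ℕ.+ (suc k ℕ.+ n′) ≡ k ℕ.+ (1 ℕ.* suc k ℕ.+ n′)
      rearrange = ℕ-Solver.solve-∀
  counts𝒜 : Counts (OfLengthAndSum 𝒜 m n) (multisum 1 0 1 m n)
  counts𝒜 = subst (Counts _) (sym (multisum-101 m n))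
    (counts-by-⊎ 𝒜-split 𝒜-join 𝒜-disjoint₁ counts𝒞
      (counts-by-⊎ id id 𝒜-disjoint₂
        (counts-extended (1 ∷ 1 ∷ []) 2 𝒞 (multisum 1 2 4) m n
          λ m′ n′ eq₁ eq₂ → proj₂ (counts-multisum b m′ n′ (later 1 2 2 eq₁ eq₂)))
        (counts-extended (1 ∷ 1 ∷ 2 ∷ []) 3 𝒜 (multisum 1 0 1) m n
          λ m′ n′ eq₁ eq₂ → proj₁ (counts-multisum b m′ n′ (later 2 4 3 eq₁ eq₂)))))

-- Passage between `𝒫` and `𝒞`

atMostOneOne⁺ : ∀ {π} → 𝒜 π → multiplicity 1 π ℕ.≤ 1 → AtMostOneOne π
atMostOneOne⁺ {[]}                      _ _ = tt
atMostOneOne⁺ {_ ∷ []}                  _ _ = tt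
atMostOneOne⁺ {_ ∷ suc (suc _) ∷ _}     _ _ = s≤s (s≤s z≤n)
atMostOneOne⁺ {1 ∷ 1 ∷ _}               _ (s≤s ())
atMostOneOne⁺ {suc (suc _) ∷ 1 ∷ π}     ((pre , _) , _) _ =
  contradiction (precedes-≤ π pre) λ { (s≤s ()) }
atMostOneOne⁺ {_ ∷ zero ∷ _}            (_ , _ ∷ () ∷ _) _
atMostOneOne⁺ {zero ∷ 1 ∷ _}            (_ , () ∷ _) _

-- By monotonicity every part after the first is at least 2, so only the first can equal 1.
atMostOneOne⁻ : ∀ {π} → 𝒞 π → multiplicity 1 π ℕ.≤ 1
atMostOneOne⁻ {[]} _ = z≤n
atMostOneOne⁻ {x ∷ π} (((_ , chain) , _) , amoo) = ℕ.≤-trans (mult-∷ x π)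
  (s≤s (ℕ.≤-reflexive (cong length (List.filter-none (ℕ._≟ 1) (tail≢1 π chain amoo)))))
  where
  mult-∷ : ∀ x π → multiplicity 1 (x ∷ π) ℕ.≤ suc (multiplicity 1 π)
  mult-∷ zero          π = ℕ.n≤1+n _
  mult-∷ 1             π = ℕ.≤-refl
  mult-∷ (suc (suc _)) π = ℕ.n≤1+n _
  tail≢1 : ∀ π → Chain π → AtMostOneOne (x ∷ π) → All (_≢ 1) π
  tail≢1 []      _     _   = []
  tail≢1 (y ∷ π) chain 2≤y = All.map (λ { (s≤s (s≤s _)) () }) (chain-≤ π 2≤y chain)

𝒫⇒𝒞 : ∀ {π} → 𝒫 π → 𝒞 π
𝒫⇒𝒞 {π} p = 𝒜π , atMostOneOne⁺ 𝒜π atMostOneOne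
  where
  open 𝒫 p
  open IsPartition isPartition
  𝒜π : 𝒜 π
  𝒜π = chain⁺ π increasing positive condition , positive

𝒞⇒𝒫 : ∀ {π} → 𝒞 π → 𝒫 π
𝒞⇒𝒫 {π} c@((chain , 1≤π) , _) = record
  { isPartition  = record { increasing = chain-sorted π chain ; positive = 1≤π }
  ; condition    = chain⁻ chain
  ; atMostOneOne = atMostOneOne⁻ c
  }

-- From enumerations to generating functions

partitionTerm-1 : ∀ π → partitionTerm π (length π) (sum π) ≡ 1ℤ
partitionTerm-1 π with length π ℕ.≟ length π
... | no  ≢length = contradiction refl ≢length
... | yes _ with sum π ℕ.≟ sum π
...   | no  ≢sum = contradiction refl ≢sum
...   | yes _    = refl

partitionTerm-0 : ∀ π m n → ¬ (length π ≡ m × sum π ≡ n) → partitionTerm π m n ≡ 0ℤ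
partitionTerm-0 π m n ≢ with m ℕ.≟ length π
... | no  _    = refl
... | yes refl with n ℕ.≟ sum π
...   | no  _    = refl
...   | yes refl = contradiction (refl , refl) ≢

-- The enumeration serves as the support: each listed partition contributes 1 to x^m q^n, so the
-- contributions add up to the length of the list.
hasSum-partitionTerm : ∀ {P} {S : Series₂} →
  (∀ m n → Counts (OfLengthAndSum P m n) (S m n)) → HasSum P partitionTerm S
hasSum-partitionTerm {P} counts m n with πs , unique , sound , complete , S≡ ← counts m n =
  πs , unique , All.map proj₁ sound ,
  (λ π p π∉πs → partitionTerm-0 π m n (λ eqs → π∉πs (complete (p , eqs)))) ,
  trans (total sound) S≡
  where
  total : ∀ {πs} → All (OfLengthAndSum P m n) πs →
    foldr ℤ._+_ 0ℤ (map (λ π → partitionTerm π m n) πs) ≡ + length πs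
  total []                              = refl
  total (_∷_ {π} (_ , refl , refl) rest) = cong₂ ℤ._+_ (partitionTerm-1 π) (total rest)

𝒫-hasSum : HasSum 𝒫 partitionTerm (multisum 1 2 4)
𝒫-hasSum = hasSum-partitionTerm λ m n →
  counts-⇔ (λ (c , eqs) → 𝒞⇒𝒫 c , eqs) (λ (p , eqs) → 𝒫⇒𝒞 p , eqs)
    (proj₂ (counts-multisum (m ℕ.+ n) m n ℕ.≤-refl))

mainTheorem6 : ∃ λ (S : Series₂) → HasSum 𝒫 partitionTerm S × HasSum U multisumTerm S
mainTheorem6 = multisum 1 2 4 , 𝒫-hasSum , multisumTerm-hasSum
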